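{- The matrices $R,L,A^*$ satisfy the following relations: $$RA^*=qA^*R,\qquad LA^*=q^{ -1}A^*L,$$ $$L^2R-q(q+1)LRL+q^3RL^2=-q^{N+M}(q+1)L,$$ $$LR^2-q(q+1)RLR+q^3R^2L=-q^{N+M}(q+1)R.$$
   Context: Let $\mathbb F_q$ be a finite field with $q$ elements, let $N,M$ be positive integers, let $H$ be a vector space over $\mathbb F_q$ of dimension $N+M$, and fix a subspace $h\subseteq H$ of dimension $M$. Let $X$ be the set of subspaces $y\subseteq H$ with $y\cap h=0$, partially ordered by inclusion (the Attenuated Space poset $\mathcal A_q(N,M)$). For $y,z\in X$, $z$ covers $y$ when $y\subseteq z$ and $\dim z-\dim y=1$. Let $\mathrm{Mat}_X(\mathbb C)$ be the algebra of complex matrices with rows and columns indexed by $X$. The raising matrix $R\in\mathrm{Mat}_X(\mathbb C)$ has $(y,z)$-entry $1$ if $y$ covers $z$, and $0$ otherwise. The $q$-lowering matrix $L\in\mathrm{Mat}_X(\mathbb C)$ has $(y,z)$-entry $q^{\dim y}$ if $z$ covers $y$, and $0$ otherwise. The matrix $A^*\in\mathrm{Mat}_X(\mathbb C)$ is diagonal with $(y,y)$-entry $q^{ -\dim y}$ for $y\in X$. -}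

module Defs where

open import Level using (Level; _⊔_) renaming (suc to lsuc)
open import Algebra.Apartness.Bundles using (HeytingCommutativeRing; HeytingField)
open import Algebra.Bundles using (CommutativeRing)
open import Algebra.Module.Bundles using (Module)
import Algebra.Properties.Semiring.Exp as Exp
import Algebra.Properties.Semiring.Mult as Mult
import Algebra.Properties.CommutativeMonoid.Sum as Sum
import Algebra.Properties.Group as GroupProperties
open import Data.Bool.Base using (if_then_else_)
open import Data.Fin.Base using (Fin; toℕ; fromℕ<; finToFun; funToFin; combine)
open import Data.Fin.Properties
  using (all?; any?; injective⇒≤; toℕ-fromℕ<; finToFun-funToFin; funToFin-finToFin)
  renaming (_≟_ to _≟ᶠ_)
open import Data.List.Base using (List; []; _∷_; concatMap; deduplicate; length; lookup; allFin)
import Data.List.Membership.Setoid as Membership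
import Data.List.Membership.Setoid.Properties as Membershipₚ
open import Data.List.Membership.Propositional using (lose)
open import Data.List.Membership.Propositional.Properties using (∈-allFin)
open import Data.List.Relation.Unary.All using (All; []; _∷_)
open import Data.List.Relation.Unary.AllPairs using ([]; _∷_)
open import Data.List.Relation.Unary.Any as Any using (here)
open import Data.List.Relation.Unary.Any.Properties using (lookup-index; concatMap⁺)
open import Data.List.Relation.Unary.Enumerates.Setoid using (IsEnumeration)
import Data.List.Relation.Unary.Unique.Setoid as UniqueSetoid
open import Data.List.Relation.Unary.Unique.DecSetoid.Properties using (deduplicate-!)
open import Data.Nat.Base as ℕ using (ℕ; zero; suc; NonZero)
import Data.Nat.Properties as ℕₚ
open import Data.Product.Base using (∃; Σ; _×_; _,_; proj₁; proj₂)
open import Data.Vec.Functional using (Vector)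
open import Function.Base using (_∘_)
open import Function.Bundles using (Inverse)
open import Relation.Binary.Bundles using (Setoid; DecSetoid)
open import Relation.Binary.PropositionalEquality as ≡ using (_≡_)
import Relation.Binary.Reasoning.Setoid as SetoidReasoning
open import Relation.Nullary.Decidable
  using (Dec; yes; no; does; map′; _×-dec_; _→-dec_)
open import Relation.Nullary.Negation using (¬_; contradiction)
open import Relation.Unary as Unary using (Pred; _∈_; _⊆_; _∩_)

private
  variable
    a c ℓ ℓ# m ℓm p : Level

ring : HeytingField c ℓ ℓ# → CommutativeRing c ℓ
ring K = HeytingCommutativeRing.commutativeRing (HeytingField.heytingCommutativeRing K)

setoid : HeytingField c ℓ ℓ# → Setoid c ℓ
setoid K = CommutativeRing.setoid (ring K)

-- A setoid has n elements up to its equivalence.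
_HasSize_ : Setoid a ℓ → ℕ → Set (a ⊔ ℓ)
S HasSize n = Inverse (≡.setoid (Fin n)) S

-- In a discrete field, such as a classical one, x # y amounts to ¬ x ≈ y.
CharacteristicZero : HeytingField c ℓ ℓ# → Set ℓ#
CharacteristicZero K = ∀ n → .{{NonZero n}} → (n ×′ 1#) # 0#
  where
  open HeytingField K
  open Mult (CommutativeRing.semiring (ring K)) using () renaming (_×_ to _×′_)

module _ (S : DecSetoid a ℓ) where
  private
    module S = DecSetoid S
    open Membership S.setoid using () renaming (_∈_ to _∈ˡ_)
    open UniqueSetoid S.setoid using (Unique)

    lookup-∈ : ∀ xs (i : Fin (length xs)) {P : Pred S.Carrier ℓ} → All P xs → P (lookup xs i)
    lookup-∈ (_ ∷ _)  Fin.zero    (px ∷ _)   = px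
    lookup-∈ (_ ∷ xs) (Fin.suc i) (_  ∷ pxs) = lookup-∈ xs i pxs

    lookup-injective : ∀ {xs} → Unique xs → ∀ i j → lookup xs i S.≈ lookup xs j → i ≡ j
    lookup-injective {_ ∷ _}  (_ ∷ _)  Fin.zero    Fin.zero    _  = ≡.refl
    lookup-injective {_ ∷ xs} (x≉ ∷ _) Fin.zero    (Fin.suc j) eq =
      contradiction eq (lookup-∈ xs j x≉)
    lookup-injective {_ ∷ xs} (x≉ ∷ _) (Fin.suc i) Fin.zero    eq =
      contradiction (S.sym eq) (lookup-∈ xs i x≉)
    lookup-injective {_ ∷ _}  (_ ∷ u)  (Fin.suc i) (Fin.suc j) eq =
      ≡.cong Fin.suc (lookup-injective u i j eq)

  enumeration⇒size : ∀ xs → IsEnumeration S.setoid xs → ∃ (S.setoid HasSize_)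
  enumeration⇒size xs complete = length ys , record
    { to        = lookup ys
    ; from      = Any.index ∘ find
    ; to-cong   = λ { ≡.refl → S.refl }
    ; from-cong = λ {x} {y} x≈y → lookup-injective unique _ _
                    (S.trans (S.sym (lookup-index (find x))) (S.trans x≈y (lookup-index (find y))))
    ; inverse   = (λ { {x} ≡.refl → S.sym (lookup-index (find x)) })
                , (λ {i} {y} y≈ → lookup-injective unique _ i
                    (S.trans (S.sym (lookup-index (find y))) y≈))
    }
    where
    ys = deduplicate S._≟_ xs

    unique : Unique ys
    unique = deduplicate-! S xs

    find : ∀ x → x ∈ˡ ys
    find x = Membershipₚ.∈-deduplicate⁺ S.setoid S._≟_
               (λ z≈w w≈v → S.trans w≈v (S.sym z≈w)) (complete x)

module LinearAlgebra (F : HeytingField c ℓ ℓ#) (H : Module (ring F) m ℓm) where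
  open CommutativeRing (ring F) using (Carrier; _≈_; 0#)
  open Module H

  lc : ∀ {k} → Vector Carrier k → Vector Carrierᴹ k → Carrierᴹ
  lc α b = sum (λ i → α i *ₗ b i)
    where open Sum +ᴹ-commutativeMonoid using (sum)

  Span : ∀ {k} → Vector Carrierᴹ k → Pred Carrierᴹ (c ⊔ ℓm)
  Span b v = ∃ λ α → lc α b ≈ᴹ v

  LinearlyIndependent : ∀ {k} → Vector Carrierᴹ k → Set (c ⊔ ℓ ⊔ ℓm)
  LinearlyIndependent b = ∀ α → lc α b ≈ᴹ 0ᴹ → ∀ i → α i ≈ 0#

  record IsBasis {k} (P : Pred Carrierᴹ p) (b : Vector Carrierᴹ k) : Set (c ⊔ ℓ ⊔ m ⊔ ℓm ⊔ p) where
    field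
      ⊆-elements  : ∀ i → b i ∈ P
      independent : LinearlyIndependent b
      spanning    : P ⊆ Span b

  record IsSubspace (P : Pred Carrierᴹ p) : Set (c ⊔ m ⊔ ℓm ⊔ p) where
    field
      resp : ∀ {v w} → v ≈ᴹ w → v ∈ P → w ∈ P
      0∈   : 0ᴹ ∈ P
      +∈   : ∀ {v w} → v ∈ P → w ∈ P → (v +ᴹ w) ∈ P
      *ₗ∈  : ∀ x {v} → v ∈ P → (x *ₗ v) ∈ P

  HasDimension : ℕ → Set (c ⊔ ℓ ⊔ m ⊔ ℓm)
  HasDimension n = ∃ λ (b : Vector Carrierᴹ n) → IsBasis Unary.U b

  -- Classically every subspace of a finite-dimensional space has a basis;
  -- constructively the basis has to be carried along.
  record Subspace : Set (ℓ ⊔ m ⊔ lsuc (c ⊔ ℓm)) where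
    field
      Mem        : Pred Carrierᴹ (c ⊔ ℓm)
      isSubspace : IsSubspace Mem
      dim        : ℕ
      basis      : Vector Carrierᴹ dim
      isBasis    : IsBasis Mem basis

    open IsSubspace isSubspace public
    open IsBasis isBasis public

  open Subspace public using (Mem; dim)

  infix 4 _⊑_ _≐_

  _⊑_ : Subspace → Subspace → Set (c ⊔ m ⊔ ℓm)
  y ⊑ z = Mem y ⊆ Mem z

  -- The chosen bases are irrelevant to equality of subspaces.
  _≐_ : Subspace → Subspace → Set (c ⊔ m ⊔ ℓm)
  y ≐ z = (y ⊑ z) × (z ⊑ y)

  TrivialIntersection : Pred Carrierᴹ p → Pred Carrierᴹ p → Set (m ⊔ ℓm ⊔ p)
  TrivialIntersection P Q = ∀ {v} → v ∈ P ∩ Q → v ≈ᴹ 0ᴹ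


  private
    module F = CommutativeRing (ring F)
    module H = Module H
    module Σᴴ = Sum +ᴹ-commutativeMonoid
    module +ᴴ = GroupProperties +ᴹ-group
    module +ᶠ = GroupProperties F.+-group

  lc-cong : ∀ {k} {α β : Vector Carrier k} {b d : Vector Carrierᴹ k} →
            (∀ i → α i ≈ β i) → (∀ i → b i ≈ᴹ d i) → lc α b ≈ᴹ lc β d
  lc-cong α≈β b≈d = Σᴴ.sum-cong-≋ (λ i → *ₗ-cong (α≈β i) (b≈d i))

  lc-congˡ : ∀ {k} {α β : Vector Carrier k} (b : Vector Carrierᴹ k) →
             (∀ i → α i ≈ β i) → lc α b ≈ᴹ lc β b
  lc-congˡ b α≈β = lc-cong α≈β (λ _ → ≈ᴹ-refl)

  lc-congʳ : ∀ {k} (α : Vector Carrier k) {b d : Vector Carrierᴹ k} →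
             (∀ i → b i ≈ᴹ d i) → lc α b ≈ᴹ lc α d
  lc-congʳ α = lc-cong (λ _ → F.refl)

  lc-+ : ∀ {k} (α β : Vector Carrier k) (b : Vector Carrierᴹ k) →
         lc (λ i → α i F.+ β i) b ≈ᴹ lc α b +ᴹ lc β b
  lc-+ α β b = ≈ᴹ-trans (Σᴴ.sum-cong-≋ (λ i → *ₗ-distribʳ (b i) (α i) (β i)))
                        (Σᴴ.∑-distrib-+ (λ i → α i *ₗ b i) (λ i → β i *ₗ b i))

  lc-* : ∀ {k} x (α : Vector Carrier k) (b : Vector Carrierᴹ k) →
         lc (λ i → x F.* α i) b ≈ᴹ x *ₗ lc α b
  lc-* {zero}  x α b = ≈ᴹ-sym (*ₗ-zeroʳ x)
  lc-* {suc k} x α b = ≈ᴹ-trans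
    (+ᴹ-cong (*ₗ-assoc x _ _) (lc-* x (α ∘ Fin.suc) (b ∘ Fin.suc)))
    (≈ᴹ-sym (*ₗ-distribˡ x _ _))

  lc-0 : ∀ {k} (b : Vector Carrierᴹ k) → lc (λ _ → 0#) b ≈ᴹ 0ᴹ
  lc-0 {zero}  b = ≈ᴹ-refl
  lc-0 {suc k} b = ≈ᴹ-trans (+ᴹ-cong (*ₗ-zeroˡ _) (lc-0 (b ∘ Fin.suc))) (+ᴹ-identityˡ 0ᴹ)

  lc-single : ∀ {k} (b : Vector Carrierᴹ k) i → b i ∈ Span b
  lc-single {suc k} b Fin.zero = (λ { Fin.zero → F.1# ; (Fin.suc _) → 0# }) ,
    ≈ᴹ-trans (+ᴹ-cong (*ₗ-identityˡ _) (lc-0 (b ∘ Fin.suc))) (+ᴹ-identityʳ _)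
  lc-single {suc k} b (Fin.suc i) with lc-single (b ∘ Fin.suc) i
  ... | α , αb≈ = (λ { Fin.zero → 0# ; (Fin.suc j) → α j }) ,
    ≈ᴹ-trans (+ᴹ-cong (*ₗ-zeroˡ _) αb≈) (+ᴹ-identityˡ _)

  lc-injective : ∀ {k} {b : Vector Carrierᴹ k} → LinearlyIndependent b →
                 ∀ {α β} → lc α b ≈ᴹ lc β b → ∀ i → α i ≈ β i
  lc-injective {b = b} indep {α} {β} eq i = +ᶠ.x∙y⁻¹≈ε⇒x≈y _ _
    (indep (λ j → α j F.- β j) (+ᴴ.∙-cancelʳ (lc β b) _ _ lemma) i)
    where
    open SetoidReasoning ≈ᴹ-setoid
    cancel : ∀ j → (α j F.- β j) F.+ β j ≈ α j
    cancel j = F.trans (F.+-assoc _ _ _)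
      (F.trans (F.+-congˡ (F.-‿inverseˡ (β j))) (F.+-identityʳ (α j)))
    lemma : lc (λ j → α j F.- β j) b +ᴹ lc β b ≈ᴹ 0ᴹ +ᴹ lc β b
    lemma = begin
      lc (λ j → α j F.- β j) b +ᴹ lc β b   ≈⟨ lc-+ (λ j → α j F.- β j) β b ⟨
      lc (λ j → (α j F.- β j) F.+ β j) b   ≈⟨ lc-congˡ b cancel ⟩
      lc α b                               ≈⟨ eq ⟩
      lc β b                               ≈⟨ +ᴹ-identityˡ _ ⟨
      0ᴹ +ᴹ lc β b                         ∎

  Span-isSubspace : ∀ {k} (b : Vector Carrierᴹ k) → IsSubspace (Span b)
  Span-isSubspace b = record
    { resp = λ { v≈w (α , αb≈v) → α , ≈ᴹ-trans αb≈v v≈w }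
    ; 0∈   = (λ _ → 0#) , lc-0 b
    ; +∈   = λ { (α , αb≈v) (β , βb≈w) → _ , ≈ᴹ-trans (lc-+ α β b) (+ᴹ-cong αb≈v βb≈w) }
    ; *ₗ∈  = λ { x (α , αb≈v) → _ , ≈ᴹ-trans (lc-* x α b) (*ₗ-cong F.refl αb≈v) }
    }

  lc∈ : ∀ {P : Pred Carrierᴹ p} → IsSubspace P →
        ∀ {k} (α : Vector Carrier k) {b : Vector Carrierᴹ k} → (∀ i → b i ∈ P) → lc α b ∈ P
  lc∈ P {zero}  α b∈ = IsSubspace.0∈ P
  lc∈ P {suc k} α b∈ = IsSubspace.+∈ P (IsSubspace.*ₗ∈ P _ (b∈ Fin.zero))
                                       (lc∈ P (α ∘ Fin.suc) (b∈ ∘ Fin.suc))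

  Span⊆ : ∀ {P : Pred Carrierᴹ p} → IsSubspace P →
          ∀ {k} {b : Vector Carrierᴹ k} → (∀ i → b i ∈ P) → Span b ⊆ P
  Span⊆ P b∈ (α , αb≈v) = IsSubspace.resp P αb≈v (lc∈ P α b∈)

  span : ∀ {k} (b : Vector Carrierᴹ k) → LinearlyIndependent b → Subspace
  span b indep = record
    { Mem        = Span b
    ; isSubspace = Span-isSubspace b
    ; basis      = b
    ; isBasis    = record { ⊆-elements = lc-single b ; independent = indep ; spanning = λ v∈ → v∈ }
    }

module FiniteLinearAlgebra
  {q : ℕ} (F : HeytingField c ℓ ℓ#) (F-size : setoid F HasSize q) (H : Module (ring F) m ℓm) where

  open LinearAlgebra F H
  open Module H
  private
    module F = CommutativeRing (ring F)
    open F using (Carrier; _≈_; 0#)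
    module E = Inverse F-size
    module +ᴴ = GroupProperties +ᴹ-group

  funToFin-cong : ∀ {k l} {f g : Fin k → Fin l} → (∀ i → f i ≡ g i) → funToFin f ≡ funToFin g
  funToFin-cong {zero}  f≗g = ≡.refl
  funToFin-cong {suc k} f≗g =
    ≡.cong₂ combine (f≗g Fin.zero) (funToFin-cong (f≗g ∘ Fin.suc))

  from-injective : ∀ {x y} → E.from x ≡ E.from y → x ≈ y
  from-injective {x} {y} eq = F.trans (F.sym (E.strictlyInverseˡ x))
    (F.trans (E.to-cong eq) (E.strictlyInverseˡ y))

  vec : ∀ k → Fin (q ℕ.^ k) → Vector Carrier k
  vec k i = E.to ∘ finToFun {q} {k} i

  code : ∀ {k} → Vector Carrier k → Fin (q ℕ.^ k)
  code α = funToFin (E.from ∘ α)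

  vec-code : ∀ {k} (α : Vector Carrier k) i → vec k (code α) i ≈ α i
  vec-code {k} α i = F.trans (E.to-cong (finToFun-funToFin (E.from ∘ α) i)) (E.strictlyInverseˡ (α i))

  code-vec : ∀ k (i : Fin (q ℕ.^ k)) → code (vec k i) ≡ i
  code-vec k i = ≡.trans (funToFin-cong (λ j → E.strictlyInverseʳ (finToFun {q} {k} i j)))
                           (funToFin-finToFin {k} {q} i)

  code-cong : ∀ {k} {α β : Vector Carrier k} → (∀ i → α i ≈ β i) → code α ≡ code β
  code-cong α≈β = funToFin-cong (λ i → E.from-cong (α≈β i))

  code-injective : ∀ {k} {α β : Vector Carrier k} → code α ≡ code β → ∀ i → α i ≈ β i
  code-injective {k} {α} {β} eq i = F.trans (F.sym (vec-code α i))
    (F.trans (E.to-cong (≡.cong (λ j → finToFun {q} {k} j i) eq)) (vec-code β i))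

  Invariant : ∀ {k} → Pred (Vector Carrier k) p → Set _
  Invariant P = ∀ {α β} → (∀ i → α i ≈ β i) → α ∈ P → β ∈ P

  ∃ᵛ? : ∀ {k} {P : Pred (Vector Carrier k) p} → Invariant P → Unary.Decidable P → Dec (∃ P)
  ∃ᵛ? {k = k} inv P? = map′ (λ { (i , Pi) → vec k i , Pi })
                    (λ { (α , Pα) → code α , inv (λ i → F.sym (vec-code α i)) Pα })
                    (any? (P? ∘ vec k))

  ∀ᵛ? : ∀ {k} {P : Pred (Vector Carrier k) p} → Invariant P → Unary.Decidable P → Dec (∀ α → P α)
  ∀ᵛ? {k = k} inv P? = map′ (λ ∀P α → inv (vec-code α) (∀P (code α))) (λ ∀P → ∀P ∘ vec k)
                            (all? (P? ∘ vec k))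

  1<q : 1 ℕ.< q
  1<q = go q F-size
    where
    0≉1 : ¬ 0# ≈ F.1#
    0≉1 0≈1 = HeytingField.#-irrefl F F.refl (HeytingField.invertible⇒# F {0#} {0#}
      (0# , collapse _ , collapse _))
      where
      collapse : ∀ x → x ≈ F.1#
      collapse x = F.trans (F.trans (F.sym (F.*-identityʳ x))
        (F.trans (F.*-congˡ (F.sym 0≈1)) (F.zeroʳ x))) 0≈1

    go : ∀ r → setoid F HasSize r → 1 ℕ.< r
    go zero          e = contradiction (Inverse.from e 0#) λ ()
    go (suc zero)    e = contradiction (F.trans (F.sym (Inverse.strictlyInverseˡ e 0#))
      (F.trans (Inverse.to-cong e (unique _ _)) (Inverse.strictlyInverseˡ e F.1#))) 0≉1
      where
      unique : (i j : Fin 1) → i ≡ j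
      unique Fin.zero Fin.zero = ≡.refl
    go (suc (suc r)) e = ℕ.s≤s (ℕ.s≤s ℕ.z≤n)

  q-nonZero : NonZero q
  q-nonZero = ℕ.>-nonZero (ℕₚ.<-trans (ℕ.s≤s ℕ.z≤n) 1<q)

  infix 4 _≟_

  _≟_ : ∀ x y → Dec (x ≈ y)
  x ≟ y = map′ from-injective E.from-cong (E.from x ≟ᶠ E.from y)

  independent⇒≤ : ∀ {k l} {b : Vector Carrierᴹ k} {d : Vector Carrierᴹ l} →
                  LinearlyIndependent b → (∀ i → b i ∈ Span d) → k ℕ.≤ l
  independent⇒≤ {k} {l} {b} {d} indep b∈ = ℕₚ.≮⇒≥ λ l<k →
    ℕₚ.<⇒≱ (ℕₚ.^-monoʳ-< q 1<q l<k) (injective⇒≤ {f = f} f-injective)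
    where
    expand : ∀ α → lc α b ∈ Span d
    expand α = lc∈ (Span-isSubspace d) α b∈

    f : Fin (q ℕ.^ k) → Fin (q ℕ.^ l)
    f i = code (proj₁ (expand (vec k i)))

    f-injective : ∀ {i j} → f i ≡ f j → i ≡ j
    f-injective {i} {j} eq = ≡.trans (≡.sym (code-vec k i)) (≡.trans (code-cong (lc-injective indep
      (≈ᴹ-trans (≈ᴹ-sym (proj₂ (expand (vec k i))))
      (≈ᴹ-trans (lc-congˡ d (code-injective eq)) (proj₂ (expand (vec k j))))))) (code-vec k j))

  dim-mono : ∀ {y z} → y ⊑ z → dim y ℕ.≤ dim z
  dim-mono {y} {z} y⊑z = independent⇒≤ (Subspace.independent y)
    (λ i → Subspace.spanning z (y⊑z (Subspace.⊆-elements y i)))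

  dim-cong : ∀ {y z} → y ≐ z → dim y ≡ dim z
  dim-cong {y} {z} (y⊑z , z⊑y) = ℕₚ.≤-antisym (dim-mono {y} {z} y⊑z) (dim-mono {z} {y} z⊑y)

  module Deciding {n : ℕ} (H-dim : HasDimension n) where
    private
      e = proj₁ H-dim
      module e = IsBasis (proj₂ H-dim)

    coordinates : Carrierᴹ → Vector Carrier n
    coordinates v = proj₁ (e.spanning {v} _)

    lc-coordinates : ∀ v → lc (coordinates v) e ≈ᴹ v
    lc-coordinates v = proj₂ (e.spanning {v} _)

    isZero? : ∀ v → Dec (v ≈ᴹ 0ᴹ)
    isZero? v = map′
      (λ v≈0 → ≈ᴹ-trans (≈ᴹ-sym (lc-coordinates v)) (≈ᴹ-trans (lc-congˡ e v≈0) (lc-0 e)))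
      (λ v≈0 → e.independent (coordinates v) (≈ᴹ-trans (lc-coordinates v) v≈0))
      (all? (λ i → coordinates v i ≟ 0#))

    infix 4 _≟ᴹ_ _⊑?_

    _≟ᴹ_ : ∀ v w → Dec (v ≈ᴹ w)
    v ≟ᴹ w = map′ (+ᴴ.x∙y⁻¹≈ε⇒x≈y v w)
                  (λ v≈w → ≈ᴹ-trans (+ᴹ-congʳ v≈w) (-ᴹ‿inverseʳ w))
                  (isZero? (v +ᴹ (-ᴹ w)))

    ∀ᴹ? : {P : Pred Carrierᴹ p} → (∀ {v w} → v ≈ᴹ w → v ∈ P → w ∈ P) →
          Unary.Decidable P → Dec (∀ v → v ∈ P)
    ∀ᴹ? resp P? = map′ (λ ∀P v → resp (lc-coordinates v) (∀P (coordinates v))) (λ ∀P α → ∀P (lc α e))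
      (∀ᵛ? (λ α≈β → resp (lc-congˡ e α≈β)) (λ α → P? (lc α e)))

    Span? : ∀ {k} (b : Vector Carrierᴹ k) → Unary.Decidable (Span b)
    Span? b v = ∃ᵛ? (λ α≈β αb≈v → ≈ᴹ-trans (≈ᴹ-sym (lc-congˡ b α≈β)) αb≈v) (λ α → lc α b ≟ᴹ v)

    Mem? : ∀ y → Unary.Decidable (Mem y)
    Mem? y v = map′ (Span⊆ (Subspace.isSubspace y) (Subspace.⊆-elements y)) (Subspace.spanning y)
                    (Span? (Subspace.basis y) v)

    _⊑?_ : ∀ y z → Dec (y ⊑ z)
    y ⊑? z = map′ (λ f {v} → f v) (λ f v → f)
      (∀ᴹ? (λ v≈w f w∈y → Subspace.resp z v≈w (f (Subspace.resp y (≈ᴹ-sym v≈w) w∈y)))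
           (λ v → Mem? y v →-dec Mem? z v))

    independent? : ∀ {k} (b : Vector Carrierᴹ k) → Dec (LinearlyIndependent b)
    independent? b = ∀ᵛ?
      (λ α≈β f βb≈0 i → F.trans (F.sym (α≈β i)) (f (≈ᴹ-trans (lc-congˡ b α≈β) βb≈0) i))
      (λ α → (lc α b ≟ᴹ 0ᴹ) →-dec all? (λ i → α i ≟ 0#))

    trivialIntersection? : ∀ {k} (b : Vector Carrierᴹ k) z →
                           Dec (TrivialIntersection (Span b) (Mem z))
    trivialIntersection? b z = map′ (λ f {v} → f v) (λ f v → f)
      (∀ᴹ? (λ { v≈w f (w∈b , w∈z) → ≈ᴹ-trans (≈ᴹ-sym v≈w)
                (f (IsSubspace.resp (Span-isSubspace b) (≈ᴹ-sym v≈w) w∈b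
                   , Subspace.resp z (≈ᴹ-sym v≈w) w∈z)) })
           (λ v → (Span? b v ×-dec Mem? z v) →-dec isZero? v))

    family : ∀ k → Fin ((q ℕ.^ n) ℕ.^ k) → Vector Carrierᴹ k
    family k i j = lc (vec n (finToFun {q ℕ.^ n} {k} i j)) e

    family-surjective : ∀ {k} (b : Vector Carrierᴹ k) → ∃ λ i → ∀ j → family k i j ≈ᴹ b j
    family-surjective b = funToFin codes , λ j → ≈ᴹ-trans
      (lc-congˡ e (λ r → F.trans (F.reflexive (≡.cong (λ s → vec n s r) (finToFun-funToFin codes j)))
                                 (vec-code (coordinates (b j)) r)))
      (lc-coordinates (b j))
      where
      codes : ∀ j → Fin (q ℕ.^ n)
      codes j = code (coordinates (b j))

module AttenuatedSpace
  {q n : ℕ} (F : HeytingField c ℓ ℓ#) (F-size : setoid F HasSize q)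
  (H : Module (ring F) m ℓm) (H-dim : LinearAlgebra.HasDimension F H n)
  (h : LinearAlgebra.Subspace F H) where

  open LinearAlgebra F H
  open FiniteLinearAlgebra F F-size H
  open Deciding H-dim
  open Module H using (Carrierᴹ; _≈ᴹ_; ≈ᴹ-sym; ≈ᴹ-trans)

  X : Set (ℓ ⊔ m ⊔ lsuc (c ⊔ ℓm))
  X = Σ Subspace λ y → TrivialIntersection (Mem y) (Mem h)

  X-decSetoid : DecSetoid (ℓ ⊔ m ⊔ lsuc (c ⊔ ℓm)) (c ⊔ m ⊔ ℓm)
  X-decSetoid = record
    { Carrier = X
    ; _≈_ = λ y z → proj₁ y ≐ proj₁ z
    ; isDecEquivalence = record
      { isEquivalence = record
        { refl  = (λ v∈ → v∈) , (λ v∈ → v∈)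
        ; sym   = λ { (f , g) → g , f }
        ; trans = λ { (f , g) (f′ , g′) → (λ v∈ → f′ (f v∈)) , (λ v∈ → g (g′ v∈)) }
        }
      ; _≟_ = λ y z → (proj₁ y ⊑? proj₁ z) ×-dec (proj₁ z ⊑? proj₁ y)
      }
    }

  X-setoid : Setoid (ℓ ⊔ m ⊔ lsuc (c ⊔ ℓm)) (c ⊔ m ⊔ ℓm)
  X-setoid = DecSetoid.setoid X-decSetoid

  _Covers_ : X → X → Set (c ⊔ m ⊔ ℓm)
  (z , _) Covers (y , _) = (y ⊑ z) × (dim z ≡ dim y ℕ.+ 1)

  _covers?_ : ∀ z y → Dec (z Covers y)
  (z , _) covers? (y , _) = (y ⊑? z) ×-dec (dim z ℕₚ.≟ dim y ℕ.+ 1)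

  private
    Good : ∀ {k} → Vector Carrierᴹ k → Set (c ⊔ ℓ ⊔ m ⊔ ℓm)
    Good b = LinearlyIndependent b × TrivialIntersection (Span b) (Mem h)

    good? : ∀ {k} (b : Vector Carrierᴹ k) → Dec (Good b)
    good? b = independent? b ×-dec trivialIntersection? b h

    element : ∀ {k} {b : Vector Carrierᴹ k} → Dec (Good b) → List X
    element {b = b} (yes (indep , triv)) = (span b indep , triv) ∷ []
    element         (no _)               = []

    elementsOfDim : ℕ → List X
    elementsOfDim k = concatMap (λ i → element (good? (family k i))) (allFin _)

    elements : List X
    elements = concatMap (elementsOfDim ∘ toℕ) (allFin (suc n))

    open Membership X-setoid using () renaming (_∈_ to _∈ˡ_)

    element-complete : ∀ (x : X) {b : Vector Carrierᴹ (dim (proj₁ x))} →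
                       (∀ j → b j ≈ᴹ Subspace.basis (proj₁ x) j) → (b? : Dec (Good b)) →
                       x ∈ˡ element b?
    element-complete (y , triv) {b} b≈ (yes (indep , _)) = here
      ( (λ v∈y → let (α , αb≈v) = Subspace.spanning y v∈y in α , ≈ᴹ-trans (lc-congʳ α b≈) αb≈v)
      , Span⊆ (Subspace.isSubspace y)
          (λ i → Subspace.resp y (≈ᴹ-sym (b≈ i)) (Subspace.⊆-elements y i)))
    element-complete (y , triv) {b} b≈ (no ¬good) = contradiction
      ( (λ α αb≈0 → Subspace.independent y α (≈ᴹ-trans (≈ᴹ-sym (lc-congʳ α b≈)) αb≈0))
      , (λ { (v∈b , v∈h) → triv (Span⊆ (Subspace.isSubspace y)
          (λ i → Subspace.resp y (≈ᴹ-sym (b≈ i)) (Subspace.⊆-elements y i)) v∈b , v∈h) }))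
      ¬good

    complete : IsEnumeration X-setoid elements
    complete x@(y , _) = concatMap⁺ (elementsOfDim ∘ toℕ)
      (lose (∈-allFin (fromℕ< dim<)) (inner _ (toℕ-fromℕ< dim<)))
      where
      dim< : dim y ℕ.< suc n
      dim< = ℕ.s≤s (independent⇒≤ (Subspace.independent y)
               (λ i → IsBasis.spanning (proj₂ H-dim) _))

      inner : ∀ k → k ≡ dim y → x ∈ˡ elementsOfDim k
      inner k ≡.refl = let (i , i≈) = family-surjective (Subspace.basis y) in
        concatMap⁺ (λ i → element (good? (family k i)))
          (lose (∈-allFin i) (element-complete x i≈ (good? (family k i))))

  abstract
    X-finite : ∃ (X-setoid HasSize_)
    X-finite = enumeration⇒size X-decSetoid elements complete

  ∣X∣ : ℕ
  ∣X∣ = proj₁ X-finite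

  X-element : Fin ∣X∣ → X
  X-element = Inverse.to (proj₂ X-finite)

  module Matrices {c ℓ ℓ#} (K : HeytingField c ℓ ℓ#) (char0 : CharacteristicZero K) where
    open CommutativeRing (ring K) hiding (ring; setoid; _+_; _*_; -_; 1#)
    open CommutativeRing (ring K) public using (_+_; _*_; -_; 1#)
    open Sum +-commutativeMonoid using (sum)
    open Exp semiring public using (_^_)
    open Mult semiring using () renaming (_×_ to _×′_)

    -- X is a setoid, so a matrix proper also respects _≐_ in both indices;
    -- R, L and A* do, by dim-cong, and the products then do not depend on the
    -- representatives chosen by X-element.
    Mat : Set _
    Mat = X → X → Carrier

    infix  4 _≋_
    infixl 6 _⊕_ _⊖_
    infixr 7 _∙_
    infixl 8 _·_

    _≋_ : Mat → Mat → Set _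
    A ≋ B = ∀ y z → A y z ≈ B y z

    _⊕_ _⊖_ _·_ : Mat → Mat → Mat
    (A ⊕ B) y z = A y z + B y z
    (A ⊖ B) y z = A y z - B y z
    (A · B) y z = sum (λ i → A y (X-element i) * B (X-element i) z)

    _∙_ : Carrier → Mat → Mat
    (x ∙ A) y z = x * A y z

    qᴷ : Carrier
    qᴷ = q ×′ 1#

    private
      -- An apartness x # y yields an inverse of x - y, hence the stray 0#.
      q-invertible : ∃ λ x → (x * (qᴷ - 0#) ≈ 1#) × ((qᴷ - 0#) * x ≈ 1#)
      q-invertible = HeytingField.#⇒invertible K (char0 q {{q-nonZero}})

    q⁻¹ : Carrier
    q⁻¹ = proj₁ q-invertible

    q⁻¹*q≈1 : q⁻¹ * qᴷ ≈ 1#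
    q⁻¹*q≈1 = trans (*-congˡ (sym (trans (+-congˡ -0≈0) (+-identityʳ qᴷ)))) (proj₁ (proj₂ q-invertible))
      where
      -0≈0 : - 0# ≈ 0#
      -0≈0 = GroupProperties.ε⁻¹≈ε +-group

    R L A* : Mat
    R  y z = if does (y covers? z) then 1# else 0#
    L  y z = if does (z covers? y) then qᴷ ^ dim (proj₁ y) else 0#
    A* y z = if does (DecSetoid._≟_ X-decSetoid y z) then q⁻¹ ^ dim (proj₁ y) else 0#

{-# OPTIONS --safe #-}

-- All four relations are read off entry by entry.  Every product of R and L
-- shifts the dimension by a constant, so only pairs y, z with
-- dim z = dim y + 1 = i + 1 matter, and there the entries of L²R, LRL and RL²
-- are powers of q times numbers of paths from y to z in the Hasse diagram of X.
-- The relation for R is the transpose of the one for L divided by q ^ i.  Both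
-- amount to
--
--   #(up, up, down) + q #(down, up, up) + (q + 1) q ^ (n - i - 1) [y ⊂ z]
--     = (q + 1) #(up, down, up),                  n = dim H = N + M.
--
-- All path counts follow from one formula.  If y ⊆ V, the number k of covers of
-- y in X inside V satisfies k q + q ^ dim (V ∩ h) = k + q ^ (dim V - dim y),
-- because a vector of V spans with y a cover in X exactly when it is outside
-- y + (V ∩ h).  For V an element of X two dimensions above y this gives the
-- q + 1 elements of an interval, for V = H the number of all covers, and for
-- V = y + z the number of paths (up, down, up) when y is not in z and
-- dim (y ∩ z) = i - 1.

module Submission where

open import Defs
open import Algebra.Apartness.Bundles using (HeytingField)
open import Algebra.Bundles using (CommutativeMonoid; CommutativeRing)
open import Algebra.Module.Bundles using (Module)
import Algebra.Properties.CommutativeMonoid.Sum as Sum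
import Algebra.Properties.CommutativeSemigroup as CommutativeSemigroupProperties
import Algebra.Properties.Group as GroupProperties
import Algebra.Properties.Ring as RingProperties
import Algebra.Properties.Semiring.Exp as Exp
import Algebra.Properties.Semiring.Mult as Mult
import Algebra.Properties.Semiring.Sum as SemiringSum
open import Data.Bool.Base using (if_then_else_)
open import Data.Fin.Base as Fin using (Fin; punchIn)
open import Data.Fin.Properties using (any?; punchInᵢ≢i)
open import Data.Nat.Base as ℕ using (ℕ; zero; suc; NonZero)
import Data.Nat.Properties as ℕₚ
open import Data.Nat.Tactic.RingSolver using (solve-∀)
open import Data.Product.Base using (∃; _×_; _,_; proj₁; proj₂; swap)
open import Data.Sum.Base using (_⊎_; inj₁; inj₂)
open import Data.Vec.Functional using (Vector; _∷_; [])
import Data.Vec.Functional.Relation.Binary.Equality.Setoid as VectorEquality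
open import Function.Base using (_∘_; id)
open import Function.Bundles using (Inverse)
open import Level using (Level; _⊔_) renaming (suc to lsuc)
open import Relation.Binary.Bundles using (Setoid; DecSetoid)
open import Relation.Binary.Definitions using (tri<; tri≈; tri>)
open import Relation.Binary.PropositionalEquality as ≡ using (_≡_; _≢_)
import Relation.Binary.Reasoning.Setoid as SetoidReasoning
open import Relation.Nullary.Decidable
  using (Dec; yes; no; does; map′; _×-dec_; ¬?; decidable-stable)
open import Relation.Nullary.Negation using (¬_; contradiction)
open import Relation.Unary as Unary using (Pred; _∈_; _∉_; _⊆_)
open import Relation.Unary.Properties using (U?)

-- Counting in finite setoids

private
  variable
    ℓ₁ ℓ₂ ℓ₃ ℓ₄ ℓ₅ ℓ₆ ℓ₇ ℓp : Level
    Φ Ψ : Set ℓ₁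

⟦_⟧ : Dec Φ → ℕ
⟦ d ⟧ = if does d then 1 else 0

⟦⟧-true : (d : Dec Φ) → Φ → ⟦ d ⟧ ≡ 1
⟦⟧-true (yes _) _ = ≡.refl
⟦⟧-true (no ¬x) x = contradiction x ¬x

⟦⟧-false : (d : Dec Φ) → ¬ Φ → ⟦ d ⟧ ≡ 0
⟦⟧-false (yes x) ¬x = contradiction x ¬x
⟦⟧-false (no _)  _  = ≡.refl

⟦⟧-⇔ : (d : Dec Φ) (e : Dec Ψ) → (Φ → Ψ) → (Ψ → Φ) → ⟦ d ⟧ ≡ ⟦ e ⟧
⟦⟧-⇔ (yes x) e f _ = ≡.sym (⟦⟧-true e (f x))
⟦⟧-⇔ (no ¬x) e _ g = ≡.sym (⟦⟧-false e (¬x ∘ g))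

⟦⟧-× : (d : Dec Φ) (e : Dec Ψ) → ⟦ d ×-dec e ⟧ ≡ ⟦ d ⟧ ℕ.* ⟦ e ⟧
⟦⟧-× (yes _) e = ≡.sym (ℕₚ.+-identityʳ _)
⟦⟧-× (no _)  e = ≡.refl

⟦⟧-*-cong : (d : Dec Φ) {x y : ℕ} → (Φ → x ≡ y) → ⟦ d ⟧ ℕ.* x ≡ ⟦ d ⟧ ℕ.* y
⟦⟧-*-cong (yes x) eq = ≡.cong (1 ℕ.*_) (eq x)
⟦⟧-*-cong (no _)  _  = ≡.refl

⟦⟧-split : (d : Dec Φ) (x : ℕ) → (Φ → x ≡ 1) → (¬ Φ → x ≡ 0) → x ≡ ⟦ d ⟧
⟦⟧-split (yes y) x f _ = f y
⟦⟧-split (no ¬y) x _ g = g ¬y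

module Summation (M : CommutativeMonoid ℓ₁ ℓ₂)
  {S : Setoid ℓ₃ ℓ₄} {N : ℕ} (size : S HasSize N) where
  private
    module S = Setoid S
    module E = Inverse size
    open CommutativeMonoid M
    open Sum M

  abstract
    -- Opaque, so that a sum over a setoid is never unfolded to its enumeration; `∑-sum` is the only
    -- access to that form.
    ∑ : (S.Carrier → Carrier) → Carrier
    ∑ f = sum (f ∘ E.to)

    ∑-sum : ∀ f → ∑ f ≈ sum (f ∘ E.to)
    ∑-sum f = refl

  ∑-cong : ∀ {f g} → (∀ x → f x ≈ g x) → ∑ f ≈ ∑ g
  ∑-cong f≈g = trans (∑-sum _) (trans (sum-cong-≋ (λ i → f≈g (E.to i))) (sym (∑-sum _)))

  ∑-distrib : ∀ f g → ∑ (λ x → f x ∙ g x) ≈ ∑ f ∙ ∑ g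
  ∑-distrib f g = trans (∑-sum _) (trans (∑-distrib-+ (f ∘ E.to) (g ∘ E.to))
    (sym (∙-cong (∑-sum f) (∑-sum g))))

  ∑-zero : ∀ {f} → (∀ x → f x ≈ ε) → ∑ f ≈ ε
  ∑-zero f≈0 = trans (∑-sum _)
    (trans (sum-cong-≋ (λ i → f≈0 (E.to i))) (sum-replicate-zero N))

  private
    sum-single : ∀ {k} (t : Fin k → Carrier) i → (∀ j → j ≢ i → t j ≈ ε) → sum t ≈ t i
    sum-single {suc k} t i t≈0 = trans (sum-remove {i = i} t)
      (trans (∙-congˡ (trans (sum-cong-≋ (λ j → t≈0 (punchIn i j) (punchInᵢ≢i i j)))
                             (sum-replicate-zero k)))
             (identityʳ _))

  -- The enumeration meets the class of `x` exactly once, at the index `E.from x`. The value `c` is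
  -- asked for on the whole class because the representative listed there need not be `x` itself.
  ∑-single : ∀ {f c} x → (∀ y → y S.≈ x → f y ≈ c) → (∀ y → ¬ y S.≈ x → f y ≈ ε) → ∑ f ≈ c
  ∑-single {f} x f≈c f≈0 = trans (∑-sum f) (trans
    (sum-single (f ∘ E.to) (E.from x) (λ j j≢ → f≈0 (E.to j)
      (λ j≈x → j≢ (≡.trans (≡.sym (E.strictlyInverseʳ j)) (E.from-cong j≈x)))))
    (f≈c (E.to (E.from x)) (E.strictlyInverseˡ x)))

module Counting {S : Setoid ℓ₁ ℓ₂} {N : ℕ} (size : S HasSize N) where
  private
    module S = Setoid S
    module E = Inverse size
    module Σℕ = SemiringSum ℕₚ.+-*-semiring

  open Summation ℕₚ.+-0-commutativeMonoid size public

  ∑-*ˡ : ∀ k f → ∑ (λ x → k ℕ.* f x) ≡ k ℕ.* ∑ f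
  ∑-*ˡ k f = begin
    ∑ (λ x → k ℕ.* f x)              ≡⟨ ∑-sum _ ⟩
    Σℕ.sum (λ i → k ℕ.* f (E.to i))  ≡⟨ Σℕ.*-distribˡ-sum k (f ∘ E.to) ⟨
    k ℕ.* Σℕ.sum (f ∘ E.to)          ≡⟨ ≡.cong (k ℕ.*_) (∑-sum f) ⟨
    k ℕ.* ∑ f                        ∎
    where open ≡.≡-Reasoning

  ∑-*ʳ : ∀ f k → ∑ (λ x → f x ℕ.* k) ≡ ∑ f ℕ.* k
  ∑-*ʳ f k = ≡.trans (∑-cong (λ x → ℕₚ.*-comm (f x) k))
    (≡.trans (∑-*ˡ k f) (ℕₚ.*-comm k (∑ f)))

  ∑-ones : ∑ (λ _ → 1) ≡ N
  ∑-ones = ≡.trans (∑-sum _) (go N)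
    where
    go : ∀ k → Σℕ.sum {k} (λ _ → 1) ≡ k
    go zero    = ≡.refl
    go (suc k) = ≡.cong suc (go k)

  count : {P : Pred S.Carrier ℓ₃} → Unary.Decidable P → ℕ
  count P? = ∑ (λ x → ⟦ P? x ⟧)

  module _ {P : Pred S.Carrier ℓ₃} (P? : Unary.Decidable P) where

    count-empty : (∀ x → ¬ P x) → count P? ≡ 0
    count-empty ¬P = ∑-zero (λ x → ⟦⟧-false (P? x) (¬P x))

    count-unique : (∀ {x y} → x S.≈ y → P x → P y) →
                   ∀ x → P x → (∀ {y} → P y → y S.≈ x) → count P? ≡ 1
    count-unique resp x Px unique = ∑-single x
      (λ y y≈x → ⟦⟧-true (P? y) (resp (S.sym y≈x) Px))
      (λ y y≉x → ⟦⟧-false (P? y) (y≉x ∘ unique))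

    -- On `P` the function is 1 away from `z`, so the sum differs from `count P?` only by trading a
    -- 1 for `f z`; the added 1 avoids subtraction. Adding the indicator of `z` makes the identity
    -- hold summand by summand.
    ∑-exceptional : (_≟_ : ∀ x y → Dec (x S.≈ y)) {f : S.Carrier → ℕ} →
                    (∀ {x y} → x S.≈ y → P x → P y) → (∀ {x y} → x S.≈ y → f x ≡ f y) →
                    ∀ z → P z → (∀ x → P x → ¬ x S.≈ z → f x ≡ 1) →
                    ∑ (λ x → ⟦ P? x ⟧ ℕ.* f x) ℕ.+ 1 ≡ count P? ℕ.+ f z
    ∑-exceptional _≟_ {f} resp f-cong z Pz f≡1 = begin
      ∑ (λ x → ⟦ P? x ⟧ ℕ.* f x) ℕ.+ 1
        ≡⟨ ≡.cong (∑ (λ x → ⟦ P? x ⟧ ℕ.* f x) ℕ.+_) one ⟨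
      ∑ (λ x → ⟦ P? x ⟧ ℕ.* f x) ℕ.+ count (_≟ z)
        ≡⟨ ∑-distrib _ _ ⟨
      ∑ (λ x → ⟦ P? x ⟧ ℕ.* f x ℕ.+ ⟦ x ≟ z ⟧)
        ≡⟨ ∑-cong pointwise ⟩
      ∑ (λ x → ⟦ P? x ⟧ ℕ.+ ⟦ x ≟ z ⟧ ℕ.* f z)
        ≡⟨ ∑-distrib _ _ ⟩
      count P? ℕ.+ ∑ (λ x → ⟦ x ≟ z ⟧ ℕ.* f z)
        ≡⟨ ≡.cong (count P? ℕ.+_) (∑-*ʳ _ (f z)) ⟩
      count P? ℕ.+ count (_≟ z) ℕ.* f z
        ≡⟨ ≡.cong (λ k → count P? ℕ.+ k ℕ.* f z) one ⟩
      count P? ℕ.+ 1 ℕ.* f z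
        ≡⟨ ≡.cong (count P? ℕ.+_) (ℕₚ.*-identityˡ (f z)) ⟩
      count P? ℕ.+ f z ∎
      where
      open ≡.≡-Reasoning

      one : count (_≟ z) ≡ 1
      one = ∑-single z (λ x → ⟦⟧-true (x ≟ z)) (λ x → ⟦⟧-false (x ≟ z))

      pointwise : ∀ x → ⟦ P? x ⟧ ℕ.* f x ℕ.+ ⟦ x ≟ z ⟧ ≡ ⟦ P? x ⟧ ℕ.+ ⟦ x ≟ z ⟧ ℕ.* f z
      pointwise x with P? x | x ≟ z
      ... | yes _  | yes x≈z = ≡.trans (≡.cong (λ k → k ℕ.+ 0 ℕ.+ 1) (f-cong x≈z))
                                         (ℕₚ.+-comm (f z ℕ.+ 0) 1)
      ... | yes Px | no x≉z  = ≡.cong (λ k → 1 ℕ.* k ℕ.+ 0) (f≡1 x Px x≉z)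
      ... | no ¬Px | yes x≈z = contradiction (resp (S.sym x≈z) Pz) ¬Px
      ... | no _   | no _    = ≡.refl

module _ {S : Setoid ℓ₁ ℓ₂} {T : Setoid ℓ₃ ℓ₄} {N L : ℕ} (sizeS : S HasSize N) (sizeT : T HasSize L) where
  private
    module S = Inverse sizeS
    module T = Inverse sizeT
    module C = Counting sizeS
    module D = Counting sizeT
    open Sum ℕₚ.+-0-commutativeMonoid using (sum; ∑-comm)

  double-counting : (f : Setoid.Carrier S → Setoid.Carrier T → ℕ) →
                    C.∑ (λ x → D.∑ (f x)) ≡ D.∑ (λ y → C.∑ (λ x → f x y))
  double-counting f = begin
    C.∑ (λ x → D.∑ (f x))                        ≡⟨ C.∑-cong (λ x → D.∑-sum (f x)) ⟩
    C.∑ (λ x → sum (λ j → f x (T.to j)))         ≡⟨ C.∑-sum _ ⟩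
    sum (λ i → sum (λ j → f (S.to i) (T.to j)))  ≡⟨ ∑-comm (λ i j → f (S.to i) (T.to j)) ⟩
    sum (λ j → sum (λ i → f (S.to i) (T.to j)))  ≡⟨ D.∑-sum _ ⟨
    D.∑ (λ y → sum (λ i → f (S.to i) y))         ≡⟨ D.∑-cong (λ y → C.∑-sum (λ x → f x y)) ⟨
    D.∑ (λ y → C.∑ (λ x → f x y))                ∎
    where open ≡.≡-Reasoning

  -- `R` is the graph of a bijection between `P` and `Q`: its row sums are the indicator of `P`, its
  -- column sums that of `Q`, and both counts are the number of pairs in `R`.
  count-bijection : {P : Pred (Setoid.Carrier S) ℓ₅} {Q : Pred (Setoid.Carrier T) ℓ₆}
                    (P? : Unary.Decidable P) (Q? : Unary.Decidable Q)
                    {R : Setoid.Carrier S → Setoid.Carrier T → Set ℓ₇} (R? : ∀ x y → Dec (R x y)) →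
                    (∀ x → D.count (R? x) ≡ ⟦ P? x ⟧) →
                    (∀ y → C.count (λ x → R? x y) ≡ ⟦ Q? y ⟧) →
                    C.count P? ≡ D.count Q?
  count-bijection P? Q? R? left right = ≡.trans (C.∑-cong (λ x → ≡.sym (left x)))
    (≡.trans (double-counting (λ x y → ⟦ R? x y ⟧)) (D.∑-cong right))

-- Dimensions of subspaces over a finite field

module Dimension {c ℓ ℓ# m ℓm : Level} {q n : ℕ} (F : HeytingField c ℓ ℓ#) (F-size : setoid F HasSize q)
  (H : Module (ring F) m ℓm) (H-dim : LinearAlgebra.HasDimension F H n) where

  open LinearAlgebra F H
  open FiniteLinearAlgebra F F-size H
  open Deciding H-dim
  open Module H
  private
    module F = CommutativeRing (ring F)
    module Fᵥ = VectorEquality F.setoid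
    module F-size = Inverse F-size
    module +ᴴ = GroupProperties +ᴹ-group
    open F using (Carrier; _≈_; 0#; 1#)
    module e = IsBasis (proj₂ H-dim)
    e = proj₁ H-dim

  -- The apartness of F is only known to be tight, but over a finite field
  -- the double negation can be removed by searching for the inverse.
  inverse : ∀ x → ¬ x ≈ 0# → ∃ λ y → y F.* x ≈ 1#
  inverse x x≉0 = decidable-stable
    (map′ (λ { (i , eq) → F-size.to i , eq })
          (λ { (y , yx≈1) → F-size.from y ,
                 F.trans (F.*-congʳ (F-size.strictlyInverseˡ y)) yx≈1 })
          (any? (λ i → F-size.to i F.* x ≟ 1#)))
    (λ ∄y → x≉0 (proj₁ (HeytingField.tight F x 0#) (λ x#0 →
      let (y , yx≈1 , _) = HeytingField.#⇒invertible F x#0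
      in ∄y (y , F.trans (F.*-congˡ (F.sym x-0≈x)) yx≈1))))
    where
    x-0≈x : x F.- 0# ≈ x
    x-0≈x = F.trans (F.+-congˡ (GroupProperties.ε⁻¹≈ε F.+-group)) (F.+-identityʳ x)

  abstract
    mem? : ∀ y → Unary.Decidable (Mem y)
    mem? = Mem?

  ∃ᴹ? : {P : Pred Carrierᴹ ℓp} → (∀ {v w} → v ≈ᴹ w → v ∈ P → w ∈ P) →
        Unary.Decidable P → Dec (∃ P)
  ∃ᴹ? resp P? = map′
    (λ { (α , Pα) → lc α e , Pα })
    (λ { (v , Pv) → coordinates v , resp (≈ᴹ-sym (lc-coordinates v)) Pv })
    (∃ᵛ? (λ α≈β → resp (lc-congˡ e α≈β)) (λ α → P? (lc α e)))

  -- Cardinalities of subspaces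

  vectors-size : ∀ k → Fᵥ.≋-setoid k HasSize (q ℕ.^ k)
  vectors-size k = record
    { to        = vec k
    ; from      = code
    ; to-cong   = λ { ≡.refl i → F.refl }
    ; from-cong = code-cong
    ; inverse   = (λ { {x} ≡.refl → vec-code x })
                , (λ {i} y≈ → ≡.trans (code-cong y≈) (code-vec k i))
    }

  H-size : ≈ᴹ-setoid HasSize (q ℕ.^ n)
  H-size = record
    { to        = λ i → lc (vec n i) e
    ; from      = λ v → code (coordinates v)
    ; to-cong   = λ { ≡.refl → ≈ᴹ-refl }
    ; from-cong = λ {v} {w} v≈w → code-cong (lc-injective e.independent
                    (≈ᴹ-trans (lc-coordinates v) (≈ᴹ-trans v≈w (≈ᴹ-sym (lc-coordinates w)))))
    ; inverse   = (λ { {v} ≡.refl → ≈ᴹ-trans (lc-congˡ e (vec-code (coordinates v))) (lc-coordinates v) })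
                , (λ {i} {v} v≈ → ≡.trans (code-cong (lc-injective e.independent
                    (≈ᴹ-trans (lc-coordinates v) v≈))) (code-vec n i))
    }

  module #ᴴ = Counting H-size
  module #ⱽ {k : ℕ} = Counting (vectors-size k)

  -- Linear combinations of the basis match coefficient vectors with elements of `y`: spanning gives
  -- the existence and independence the uniqueness of the coefficients.
  card≡q^dim : ∀ y → #ᴴ.count (mem? y) ≡ q ℕ.^ dim y
  card≡q^dim y = ≡.trans
    (≡.sym (count-bijection (vectors-size (dim y)) H-size U? (mem? y)
              (λ α v → lc α b ≟ᴹ v)
              (λ α → #ᴴ.count-unique (λ v → lc α b ≟ᴹ v) (λ v≈w αb≈v → ≈ᴹ-trans αb≈v v≈w)
                       (lc α b) ≈ᴹ-refl ≈ᴹ-sym)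
              (λ v → ⟦⟧-split (mem? y v) _
                (λ v∈y → let (α , αb≈v) = Subspace.spanning y v∈y in
                   #ⱽ.count-unique (λ β → lc β b ≟ᴹ v)
                     (λ β≈γ βb≈v → ≈ᴹ-trans (≈ᴹ-sym (lc-congˡ b β≈γ)) βb≈v)
                     α αb≈v
                     (λ βb≈v → lc-injective (Subspace.independent y) (≈ᴹ-trans βb≈v (≈ᴹ-sym αb≈v))))
                (λ v∉y → #ⱽ.count-empty (λ β → lc β b ≟ᴹ v)
                   (λ β βb≈v → v∉y (Span⊆ (Subspace.isSubspace y) (Subspace.⊆-elements y)
                                           (β , βb≈v)))))))
    #ⱽ.∑-ones
    where b = Subspace.basis y

  count-translate : ∀ {P : Pred Carrierᴹ ℓp} (P? : Unary.Decidable P) →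
                    (∀ {v w} → v ≈ᴹ w → v ∈ P → w ∈ P) →
                    ∀ u → #ᴴ.count (λ v → P? (v +ᴹ u)) ≡ #ᴴ.count P?
  count-translate P? resp u = count-bijection H-size H-size (λ v → P? (v +ᴹ u)) P? R?
    (λ v → ⟦⟧-split (P? (v +ᴹ u)) _
      (λ Pvu → #ᴴ.count-unique (R? v)
        (λ { w≈x (eq , Pw) → ≈ᴹ-trans eq w≈x , resp w≈x Pw })
        (v +ᴹ u) (≈ᴹ-refl , Pvu) (≈ᴹ-sym ∘ proj₁))
      (λ ¬Pvu → #ᴴ.count-empty (R? v) (λ { w (eq , Pw) → ¬Pvu (resp (≈ᴹ-sym eq) Pw) })))
    (λ w → ⟦⟧-split (P? w) _
      (λ Pw → #ᴴ.count-unique (λ v → R? v w)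
        (λ { v≈x (eq , Pw) → ≈ᴹ-trans (+ᴹ-congʳ (≈ᴹ-sym v≈x)) eq , Pw })
        (w +ᴹ (-ᴹ u)) (cancel w , Pw)
        (λ { {v} (eq , _) → +ᴴ.∙-cancelʳ u _ _ (≈ᴹ-trans eq (≈ᴹ-sym (cancel w))) }))
      (λ ¬Pw → #ᴴ.count-empty (λ v → R? v w) (λ { v (_ , Pw) → ¬Pw Pw })))
    where
    R? : ∀ v w → Dec ((v +ᴹ u ≈ᴹ w) × _)
    R? v w = (v +ᴹ u ≟ᴹ w) ×-dec P? w

    cancel : ∀ w → (w +ᴹ (-ᴹ u)) +ᴹ u ≈ᴹ w
    cancel w = ≈ᴹ-trans (+ᴹ-assoc w _ u)
      (≈ᴹ-trans (+ᴹ-congˡ (-ᴹ‿inverseˡ u)) (+ᴹ-identityʳ w))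

  -- Adjoining vectors and building bases

  -∈ : ∀ {P : Pred Carrierᴹ ℓp} → IsSubspace P → ∀ {v} → v ∈ P → (-ᴹ v) ∈ P
  -∈ P {v} v∈P = IsSubspace.resp P (+ᴴ.inverseʳ-unique _ _ cancel) (IsSubspace.*ₗ∈ P (F.- 1#) v∈P)
    where
    cancel : v +ᴹ (F.- 1#) *ₗ v ≈ᴹ 0ᴹ
    cancel = ≈ᴹ-trans (+ᴹ-congʳ (≈ᴹ-sym (*ₗ-identityˡ v)))
      (≈ᴹ-trans (≈ᴹ-sym (*ₗ-distribʳ v 1# (F.- 1#)))
      (≈ᴹ-trans (*ₗ-congʳ (F.-‿inverseʳ 1#)) (*ₗ-zeroˡ v)))

  -- In a vanishing combination the coefficient of `v` is zero, since dividing by it would otherwise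
  -- put `v` in the span of `b`. What remains is a vanishing combination of `b`.
  independent-∷ : ∀ {k} {v} {b : Vector Carrierᴹ k} → LinearlyIndependent b → v ∉ Span b →
                  LinearlyIndependent (v ∷ b)
  independent-∷ {k} {v} {b} indep v∉b α eq = go (α Fin.zero ≟ 0#)
    where
    open SetoidReasoning ≈ᴹ-setoid
    go : Dec (α Fin.zero ≈ 0#) → ∀ i → α i ≈ 0#
    go (yes α₀≈0) Fin.zero    = α₀≈0
    go (yes α₀≈0) (Fin.suc i) = indep (α ∘ Fin.suc) (begin
      lc (α ∘ Fin.suc) b                       ≈⟨ +ᴹ-identityˡ _ ⟨
      0ᴹ +ᴹ lc (α ∘ Fin.suc) b                 ≈⟨ +ᴹ-congʳ (*ₗ-zeroˡ v) ⟨
      0# *ₗ v +ᴹ lc (α ∘ Fin.suc) b            ≈⟨ +ᴹ-congʳ (*ₗ-congʳ α₀≈0) ⟨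
      α Fin.zero *ₗ v +ᴹ lc (α ∘ Fin.suc) b    ≈⟨ eq ⟩
      0ᴹ                                       ∎) i
    go (no α₀≉0) = contradiction
      (let (x , xα₀≈1) = inverse (α Fin.zero) α₀≉0 in
       IsSubspace.resp (Span-isSubspace b)
         (begin
           x *ₗ (-ᴹ (lc (α ∘ Fin.suc) b))  ≈⟨ *ₗ-congˡ (+ᴴ.inverseˡ-unique _ _ eq) ⟨
           x *ₗ (α Fin.zero *ₗ v)          ≈⟨ *ₗ-assoc x (α Fin.zero) v ⟨
           (x F.* α Fin.zero) *ₗ v         ≈⟨ *ₗ-congʳ xα₀≈1 ⟩
           1# *ₗ v                         ≈⟨ *ₗ-identityˡ v ⟩
           v                               ∎)
         (IsSubspace.*ₗ∈ (Span-isSubspace b) x (-∈ (Span-isSubspace b) (α ∘ Fin.suc , ≈ᴹ-refl))))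
      v∉b

  -- Given by an explicit basis, so that its dimension is `suc (dim y)` by computation; later proofs
  -- rely on this silently.
  span-∷ : ∀ y {v} → v ∉ Mem y → Subspace
  span-∷ y {v} v∉y = span (v ∷ Subspace.basis y) (independent-∷ (Subspace.independent y)
    (v∉y ∘ Span⊆ (Subspace.isSubspace y) (Subspace.⊆-elements y)))

  module _ {P : Pred Carrierᴹ ℓp} (P-subspace : IsSubspace P) (P? : Unary.Decidable P) where
    private
      module P = IsSubspace P-subspace

      -- Greedy choice of a basis: a vector of `P` outside the current span is adjoined until none
      -- is left. The fuel is the number of vectors that may still be added, since no independent
      -- family in `H` has more than `n` members.
      extend : ∀ fuel {k} (b : Vector Carrierᴹ k) → LinearlyIndependent b → (∀ i → b i ∈ P) →
               fuel ℕ.+ k ≡ n → ∃ λ y → (P ⊆ Mem y) × (Mem y ⊆ P)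
      extend fuel {k} b indep b∈P fuel+k≡n
        with ∃ᴹ? (λ { v≈w (v∈P , v∉b) → P.resp v≈w v∈P ,
                      v∉b ∘ IsSubspace.resp (Span-isSubspace b) (≈ᴹ-sym v≈w) })
                 (λ v → P? v ×-dec ¬? (Span? b v))
      ... | no ∄v = span b indep
                  , (λ {v} v∈P → decidable-stable (Span? b v) (λ v∉b → ∄v (v , v∈P , v∉b)))
                  , Span⊆ P-subspace b∈P
      extend zero b indep b∈P ≡.refl | yes (v , v∈P , v∉b) = contradiction
        (independent⇒≤ {b = v ∷ b} (independent-∷ indep v∉b) (λ _ → e.spanning _)) (ℕₚ.<⇒≱ ℕₚ.≤-refl)
      extend (suc fuel) {k} b indep b∈P fuel+k≡n | yes (v , v∈P , v∉b) =
        extend fuel (v ∷ b) (independent-∷ indep v∉b)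
          (λ { Fin.zero → v∈P ; (Fin.suc i) → b∈P i }) (≡.trans (ℕₚ.+-suc fuel k) fuel+k≡n)

    -- Supplies the basis that a `Subspace` must carry. Meets and joins are made this way; their
    -- bases come from a search, so their dimensions have to be found by counting vectors.
    toSubspace : ∃ λ y → (P ⊆ Mem y) × (Mem y ⊆ P)
    toSubspace = extend n [] (λ _ _ ()) (λ ()) (ℕₚ.+-identityʳ n)

  ⊑⇒span-∷⊑ : ∀ y z {v} (v∉y : v ∉ Mem y) → y ⊑ z → v ∈ Mem z → span-∷ y v∉y ⊑ z
  ⊑⇒span-∷⊑ y z {v} v∉y y⊑z v∈z = Span⊆ (Subspace.isSubspace z) {b = v ∷ Subspace.basis y}
    (λ { Fin.zero → v∈z ; (Fin.suc i) → y⊑z (Subspace.⊆-elements y i) })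

  ∈-span-∷ : ∀ y {v} (v∉y : v ∉ Mem y) → v ∈ Mem (span-∷ y v∉y)
  ∈-span-∷ y v∉y = Subspace.⊆-elements (span-∷ y v∉y) Fin.zero

  ⊑-span-∷ : ∀ y {v} (v∉y : v ∉ Mem y) → y ⊑ span-∷ y v∉y
  ⊑-span-∷ y v∉y u∈y = Span⊆ (Subspace.isSubspace (span-∷ y v∉y))
    (λ i → Subspace.⊆-elements (span-∷ y v∉y) (Fin.suc i)) (Subspace.spanning y u∈y)

  -- A vector of `z` outside `y` could be adjoined to `y`, giving a subspace of `z` of dimension
  -- `suc (dim y)`.
  dim≤⇒⊒ : ∀ y z → y ⊑ z → dim z ℕ.≤ dim y → z ⊑ y
  dim≤⇒⊒ y z y⊑z dz≤dy {v} v∈z = decidable-stable (mem? y v) (λ v∉y →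
    ℕₚ.<⇒≱ (dim-mono {span-∷ y v∉y} {z} (⊑⇒span-∷⊑ y z v∉y y⊑z v∈z)) dz≤dy)

  -- Meets, joins and the modular law

  private
    ∧-isSubspace : ∀ y z → IsSubspace (λ v → v ∈ Mem y × v ∈ Mem z)
    ∧-isSubspace y z = record
      { resp = λ { v≈w (v∈y , v∈z) → y.resp v≈w v∈y , z.resp v≈w v∈z }
      ; 0∈   = y.0∈ , z.0∈
      ; +∈   = λ { (v∈y , v∈z) (w∈y , w∈z) → y.+∈ v∈y w∈y , z.+∈ v∈z w∈z }
      ; *ₗ∈  = λ { x (v∈y , v∈z) → y.*ₗ∈ x v∈y , z.*ₗ∈ x v∈z }
      }
      where
      module y = Subspace y
      module z = Subspace z

    Sum∈ : Subspace → Subspace → Pred Carrierᴹ _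
    Sum∈ y z v = ∃ λ u → ∃ λ w → u ∈ Mem y × w ∈ Mem z × u +ᴹ w ≈ᴹ v

    ∨-isSubspace : ∀ y z → IsSubspace (Sum∈ y z)
    ∨-isSubspace y z = record
      { resp = λ { v≈w (u , u′ , u∈y , u′∈z , eq) → u , u′ , u∈y , u′∈z , ≈ᴹ-trans eq v≈w }
      ; 0∈   = 0ᴹ , 0ᴹ , y.0∈ , z.0∈ , +ᴹ-identityˡ 0ᴹ
      ; +∈   = λ { (u , u′ , u∈y , u′∈z , eq) (w , w′ , w∈y , w′∈z , eq′) →
                   u +ᴹ w , u′ +ᴹ w′ , y.+∈ u∈y w∈y , z.+∈ u′∈z w′∈z ,
                   ≈ᴹ-trans (interchange u w u′ w′) (+ᴹ-cong eq eq′) }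
      ; *ₗ∈  = λ { x (u , u′ , u∈y , u′∈z , eq) → x *ₗ u , x *ₗ u′ , y.*ₗ∈ x u∈y , z.*ₗ∈ x u′∈z ,
                   ≈ᴹ-trans (≈ᴹ-sym (*ₗ-distribˡ x u u′)) (*ₗ-congˡ eq) }
      }
      where
      module y = Subspace y
      module z = Subspace z
      open CommutativeSemigroupProperties
        (CommutativeMonoid.commutativeSemigroup +ᴹ-commutativeMonoid) using (interchange)

    difference : ∀ {u v w} → u +ᴹ w ≈ᴹ v → w ≈ᴹ v +ᴹ (-ᴹ u)
    difference {u} {v} {w} eq = +ᴴ.x≈z//y w u v (≈ᴹ-trans (+ᴹ-comm w u) eq)

    +-difference : ∀ u v → u +ᴹ (v +ᴹ (-ᴹ u)) ≈ᴹ v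
    +-difference u v = ≈ᴹ-trans (+ᴹ-comm u _) (≈ᴹ-trans (+ᴹ-assoc v _ u)
      (≈ᴹ-trans (+ᴹ-congˡ (-ᴹ‿inverseˡ u)) (+ᴹ-identityʳ v)))

    -- Only the first summand is searched for; the second is forced to be the difference.
    Sum∈? : ∀ y z → Unary.Decidable (Sum∈ y z)
    Sum∈? y z v = map′
      (λ { (u , u∈y , v-u∈z) → u , _ , u∈y , v-u∈z , +-difference u v })
      (λ { (u , w , u∈y , w∈z , eq) → u , u∈y , Subspace.resp z (difference eq) w∈z })
      (∃ᴹ? (λ { u≈u′ (u∈y , v-u∈z) → Subspace.resp y u≈u′ u∈y ,
              Subspace.resp z (+ᴹ-congˡ (-ᴹ‿cong u≈u′)) v-u∈z })
           (λ u → mem? y u ×-dec mem? z (v +ᴹ (-ᴹ u))))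

  difference∈ : ∀ z {u w v} → u +ᴹ w ≈ᴹ v → u ∈ Mem z → v ∈ Mem z → w ∈ Mem z
  difference∈ z eq u∈z v∈z = Subspace.resp z (≈ᴹ-sym (difference eq))
    (Subspace.+∈ z v∈z (-∈ (Subspace.isSubspace z) u∈z))

  infixr 7 _∧_
  infixr 6 _∨_

  abstract
    _∧_ : Subspace → Subspace → Subspace
    y ∧ z = proj₁ (toSubspace (∧-isSubspace y z) (λ v → mem? y v ×-dec mem? z v))

    ∈-∧⁺ : ∀ y z {v} → v ∈ Mem y → v ∈ Mem z → v ∈ Mem (y ∧ z)
    ∈-∧⁺ y z v∈y v∈z = proj₁ (proj₂ (toSubspace (∧-isSubspace y z) _)) (v∈y , v∈z)

    ∈-∧⁻ : ∀ y z {v} → v ∈ Mem (y ∧ z) → v ∈ Mem y × v ∈ Mem z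
    ∈-∧⁻ y z = proj₂ (proj₂ (toSubspace (∧-isSubspace y z) _))

    _∨_ : Subspace → Subspace → Subspace
    y ∨ z = proj₁ (toSubspace (∨-isSubspace y z) (Sum∈? y z))

    ∈-∨⁺ : ∀ y z {u w v} → u ∈ Mem y → w ∈ Mem z → u +ᴹ w ≈ᴹ v → v ∈ Mem (y ∨ z)
    ∈-∨⁺ y z u∈y w∈z eq = proj₁ (proj₂ (toSubspace (∨-isSubspace y z) _)) (_ , _ , u∈y , w∈z , eq)

    ∈-∨⁻ : ∀ y z {v} → v ∈ Mem (y ∨ z) → ∃ λ u → ∃ λ w → u ∈ Mem y × w ∈ Mem z × u +ᴹ w ≈ᴹ v
    ∈-∨⁻ y z = proj₂ (proj₂ (toSubspace (∨-isSubspace y z) _))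

  ∧-lowerˡ : ∀ y z → y ∧ z ⊑ y
  ∧-lowerˡ y z = proj₁ ∘ ∈-∧⁻ y z

  ∧-lowerʳ : ∀ y z → y ∧ z ⊑ z
  ∧-lowerʳ y z = proj₂ ∘ ∈-∧⁻ y z

  ∧-greatest : ∀ w y z → w ⊑ y → w ⊑ z → w ⊑ y ∧ z
  ∧-greatest w y z w⊑y w⊑z v∈w = ∈-∧⁺ y z (w⊑y v∈w) (w⊑z v∈w)

  ∨-upperˡ : ∀ y z → y ⊑ y ∨ z
  ∨-upperˡ y z v∈y = ∈-∨⁺ y z v∈y (Subspace.0∈ z) (+ᴹ-identityʳ _)

  ∨-upperʳ : ∀ y z → z ⊑ y ∨ z
  ∨-upperʳ y z v∈z = ∈-∨⁺ y z (Subspace.0∈ y) v∈z (+ᴹ-identityˡ _)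

  ∨-least : ∀ y z w → y ⊑ w → z ⊑ w → y ∨ z ⊑ w
  ∨-least y z w y⊑w z⊑w v∈ = let (_ , _ , u∈y , u′∈z , eq) = ∈-∨⁻ y z v∈ in
    Subspace.resp w eq (Subspace.+∈ w (y⊑w u∈y) (z⊑w u′∈z))

  -- Both sides count the pairs (u , v) with u ∈ y and v - u ∈ z.
  card-∨-∧ : ∀ y z → #ᴴ.count (mem? (y ∧ z)) ℕ.* #ᴴ.count (mem? (y ∨ z)) ≡
                     #ᴴ.count (mem? z) ℕ.* #ᴴ.count (mem? y)
  card-∨-∧ y z = begin
    #ᴴ.count (mem? (y ∧ z)) ℕ.* #ᴴ.count (mem? (y ∨ z))
      ≡⟨ #ᴴ.∑-*ˡ (#ᴴ.count (mem? (y ∧ z))) _ ⟨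
    #ᴴ.∑ (λ v → #ᴴ.count (mem? (y ∧ z)) ℕ.* ⟦ mem? (y ∨ z) v ⟧)
      ≡⟨ #ᴴ.∑-cong fibre ⟨
    #ᴴ.∑ (λ v → #ᴴ.count (λ u → pair? u v))
      ≡⟨ double-counting H-size H-size (λ v u → ⟦ pair? u v ⟧) ⟩
    #ᴴ.∑ (λ u → #ᴴ.count (pair? u))
      ≡⟨ #ᴴ.∑-cong cofibre ⟩
    #ᴴ.∑ (λ u → #ᴴ.count (mem? z) ℕ.* ⟦ mem? y u ⟧)
      ≡⟨ #ᴴ.∑-*ˡ (#ᴴ.count (mem? z)) _ ⟩
    #ᴴ.count (mem? z) ℕ.* #ᴴ.count (mem? y)
      ∎
    where
    open ≡.≡-Reasoning

    pair? : ∀ u v → Dec (u ∈ Mem y × (v +ᴹ (-ᴹ u)) ∈ Mem z)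
    pair? u v = mem? y u ×-dec mem? z (v +ᴹ (-ᴹ u))

    telescope : ∀ u v w → (u +ᴹ (-ᴹ v)) +ᴹ (v +ᴹ (-ᴹ w)) ≈ᴹ u +ᴹ (-ᴹ w)
    telescope u v w = ≈ᴹ-trans (+ᴹ-assoc _ _ _) (+ᴹ-congˡ
      (≈ᴹ-trans (≈ᴹ-sym (+ᴹ-assoc _ _ _))
      (≈ᴹ-trans (+ᴹ-congʳ (-ᴹ‿inverseˡ v)) (+ᴹ-identityˡ _))))

    flip : ∀ {u v} → (u +ᴹ (-ᴹ v)) ∈ Mem z → (v +ᴹ (-ᴹ u)) ∈ Mem z
    flip u-v∈ = Subspace.resp z (+ᴴ.⁻¹-anti-homo-// _ _) (-∈ (Subspace.isSubspace z) u-v∈)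

    chain : ∀ {u v w} → (u +ᴹ (-ᴹ v)) ∈ Mem z → (v +ᴹ (-ᴹ w)) ∈ Mem z → (u +ᴹ (-ᴹ w)) ∈ Mem z
    chain u-v∈ v-w∈ = Subspace.resp z (telescope _ _ _) (Subspace.+∈ z u-v∈ v-w∈)

    cofibre : ∀ u → #ᴴ.count (pair? u) ≡ #ᴴ.count (mem? z) ℕ.* ⟦ mem? y u ⟧
    cofibre u = ≡.trans (#ᴴ.∑-cong (λ v → ⟦⟧-× (mem? y u) (mem? z (v +ᴹ (-ᴹ u)))))
      (≡.trans (#ᴴ.∑-*ˡ ⟦ mem? y u ⟧ _)
      (≡.trans (≡.cong (⟦ mem? y u ⟧ ℕ.*_) (count-translate (mem? z) (Subspace.resp z) (-ᴹ u)))
               (ℕₚ.*-comm ⟦ mem? y u ⟧ _)))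

    -- If `v` is `u₀ + w₀`, the admissible `u` form the coset of `y ∧ z` through `u₀`; if `v` is
    -- outside `y ∨ z` there are none.
    fibre : ∀ v → #ᴴ.count (λ u → pair? u v) ≡ #ᴴ.count (mem? (y ∧ z)) ℕ.* ⟦ mem? (y ∨ z) v ⟧
    fibre v with mem? (y ∨ z) v
    ... | no v∉   = ≡.trans
            (#ᴴ.count-empty (λ u → pair? u v)
              (λ { u (u∈y , v-u∈z) → v∉ (∈-∨⁺ y z u∈y v-u∈z (+-difference u v)) }))
            (≡.sym (ℕₚ.*-zeroʳ (#ᴴ.count (mem? (y ∧ z)))))
    ... | yes v∈  = let (u₀ , w₀ , u₀∈y , w₀∈z , eq) = ∈-∨⁻ y z v∈
                        v-u₀∈z = Subspace.resp z (difference eq) w₀∈z in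
      ≡.trans
        (#ᴴ.∑-cong (λ u → ⟦⟧-⇔ (pair? u v) (mem? (y ∧ z) (u +ᴹ (-ᴹ u₀)))
          (λ { (u∈y , v-u∈z) → ∈-∧⁺ y z
            (Subspace.+∈ y u∈y (-∈ (Subspace.isSubspace y) u₀∈y))
            (chain (flip v-u∈z) v-u₀∈z) })
          (λ x∈ → let (x∈y , x∈z) = ∈-∧⁻ y z x∈ in
              Subspace.resp y (≈ᴹ-trans (+ᴹ-assoc _ _ _) (≈ᴹ-trans (+ᴹ-congˡ (-ᴹ‿inverseˡ u₀)) (+ᴹ-identityʳ u)))
                (Subspace.+∈ y x∈y u₀∈y)
            , chain v-u₀∈z (flip x∈z))))
        (≡.trans (count-translate (mem? (y ∧ z)) (Subspace.resp (y ∧ z)) (-ᴹ u₀))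
                 (≡.sym (ℕₚ.*-identityʳ _)))

  q^-injective : ∀ {i j} → q ℕ.^ i ≡ q ℕ.^ j → i ≡ j
  q^-injective {i} {j} eq with ℕₚ.<-cmp i j
  ... | tri< i<j _ _ = contradiction eq (ℕₚ.<⇒≢ (ℕₚ.^-monoʳ-< q 1<q i<j))
  ... | tri≈ _ i≡j _ = i≡j
  ... | tri> _ _ j<i = contradiction (≡.sym eq) (ℕₚ.<⇒≢ (ℕₚ.^-monoʳ-< q 1<q j<i))

  -- Compares the exponents of `q` in `card-∨-∧`.
  dim-∨-∧ : ∀ y z → dim (y ∨ z) ℕ.+ dim (y ∧ z) ≡ dim y ℕ.+ dim z
  dim-∨-∧ y z = q^-injective (begin
    q ℕ.^ (dim (y ∨ z) ℕ.+ dim (y ∧ z))          ≡⟨ ℕₚ.^-distribˡ-+-* q (dim (y ∨ z)) (dim (y ∧ z)) ⟩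
    q ℕ.^ dim (y ∨ z) ℕ.* q ℕ.^ dim (y ∧ z)      ≡⟨ ≡.cong₂ ℕ._*_ (card≡q^dim (y ∨ z)) (card≡q^dim (y ∧ z)) ⟨
    #ᴴ.count (mem? (y ∨ z)) ℕ.* #ᴴ.count (mem? (y ∧ z))
                                                 ≡⟨ ℕₚ.*-comm (#ᴴ.count (mem? (y ∨ z))) (#ᴴ.count (mem? (y ∧ z))) ⟩
    #ᴴ.count (mem? (y ∧ z)) ℕ.* #ᴴ.count (mem? (y ∨ z))
                                                 ≡⟨ card-∨-∧ y z ⟩
    #ᴴ.count (mem? z) ℕ.* #ᴴ.count (mem? y)      ≡⟨ ℕₚ.*-comm (#ᴴ.count (mem? z)) (#ᴴ.count (mem? y)) ⟩
    #ᴴ.count (mem? y) ℕ.* #ᴴ.count (mem? z)      ≡⟨ ≡.cong₂ ℕ._*_ (card≡q^dim y) (card≡q^dim z) ⟩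
    q ℕ.^ dim y ℕ.* q ℕ.^ dim z                  ≡⟨ ℕₚ.^-distribˡ-+-* q (dim y) (dim z) ⟨
    q ℕ.^ (dim y ℕ.+ dim z)                      ∎)
    where open ≡.≡-Reasoning

  full : Subspace
  full = span e e.independent

  ⊑-full : ∀ y → y ⊑ full
  ⊑-full y _ = e.spanning _

  null : Subspace
  null = span [] (λ _ _ ())

  null-⊑ : ∀ y → null ⊑ y
  null-⊑ y = Span⊆ (Subspace.isSubspace y) {b = []} (λ ())

  dim≡0⇒trivial : ∀ y z → dim (y ∧ z) ≡ 0 → TrivialIntersection (Mem y) (Mem z)
  dim≡0⇒trivial y z d≡0 (v∈y , v∈z) = ≈ᴹ-sym (proj₂
    (dim≤⇒⊒ null (y ∧ z) (null-⊑ (y ∧ z)) (ℕₚ.≤-reflexive d≡0) (∈-∧⁺ y z v∈y v∈z)))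

  trivial⇒dim≡0 : ∀ y z → TrivialIntersection (Mem y) (Mem z) → dim (y ∧ z) ≡ 0
  trivial⇒dim≡0 y z triv = ℕₚ.n≤0⇒n≡0 (dim-mono {y ∧ z} {null}
    (λ v∈ → (λ ()) , ≈ᴹ-sym (triv (∈-∧⁻ y z v∈))))

-- Paths in the Hasse diagram

-- The equation amounts to `k * (q - 1) = z - x`, and `q - 1` is positive. Numbers of covers are
-- identified by checking that the expected value solves the same equation.
affine-unique : ∀ {q} → 1 ℕ.< q → ∀ {k k′ x z} →
                k ℕ.* q ℕ.+ x ≡ k ℕ.+ z → k′ ℕ.* q ℕ.+ x ≡ k′ ℕ.+ z → k ≡ k′
affine-unique {suc (suc r)} (ℕ.s≤s (ℕ.s≤s ℕ.z≤n)) {k} {k′} {x} {z} eq eq′ =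
  ℕₚ.*-cancelʳ-≡ k k′ (suc r) (ℕₚ.+-cancelʳ-≡ x _ _ (≡.trans (reduce k eq) (≡.sym (reduce k′ eq′))))
  where
  expand : ∀ r k x → k ℕ.+ (k ℕ.* suc r ℕ.+ x) ≡ k ℕ.* suc (suc r) ℕ.+ x
  expand = solve-∀

  reduce : ∀ k → k ℕ.* suc (suc r) ℕ.+ x ≡ k ℕ.+ z → k ℕ.* suc r ℕ.+ x ≡ z
  reduce k eq = ℕₚ.+-cancelˡ-≡ k _ _ (≡.trans (expand r k x) eq)

module Covering {c ℓ ℓ# m ℓm : Level} {q n : ℕ} (F : HeytingField c ℓ ℓ#) (F-size : setoid F HasSize q)
  (H : Module (ring F) m ℓm) (H-dim : LinearAlgebra.HasDimension F H n)
  (h : LinearAlgebra.Subspace F H) where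

  open LinearAlgebra F H
  open FiniteLinearAlgebra F F-size H using (dim-mono; dim-cong; 1<q; q-nonZero; module Deciding)
  open Deciding H-dim using (_⊑?_)
  open Module H
  open AttenuatedSpace F F-size H H-dim h
  open Dimension F F-size H H-dim

  module X = DecSetoid X-decSetoid

  X-size : X-setoid HasSize ∣X∣
  X-size = proj₂ X-finite

  module #ˣ = Counting X-size

  dimˣ : X → ℕ
  dimˣ y = dim (proj₁ y)

  infix 4 _⋖_ _⋖?_ _≤?_ _≈?_

  _⋖_ : X → X → Set (c ⊔ m ⊔ ℓm)
  y ⋖ z = z Covers y

  abstract
    _⋖?_ : ∀ y z → Dec (y ⋖ z)
    y ⋖? z = z covers? y

    _≤?_ : ∀ y z → Dec (y ⊑ z)
    _≤?_ = _⊑?_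

    _≈?_ : ∀ y z → Dec (y X.≈ z)
    _≈?_ = X._≟_

  ⋖-dim : ∀ (y z : X) → y ⋖ z → dimˣ z ≡ suc (dimˣ y)
  ⋖-dim y z (_ , eq) = ≡.trans eq (ℕₚ.+-comm (dimˣ y) 1)

  ⋖-intro : ∀ (y z : X) → proj₁ y ⊑ proj₁ z → dimˣ z ≡ suc (dimˣ y) → y ⋖ z
  ⋖-intro y z y⊑z eq = y⊑z , ≡.trans eq (ℕₚ.+-comm 1 (dimˣ y))

  dimˣ-cong : ∀ (y z : X) → y X.≈ z → dimˣ y ≡ dimˣ z
  dimˣ-cong y z = dim-cong {proj₁ y} {proj₁ z}

  ⋖-respʳ : ∀ (x y z : X) → y X.≈ z → x ⋖ y → x ⋖ z
  ⋖-respʳ x y z y≈z x⋖y = ⋖-intro x z (proj₁ y≈z ∘ proj₁ x⋖y)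
    (≡.trans (≡.sym (dimˣ-cong y z y≈z)) (⋖-dim x y x⋖y))

  ⋖-respˡ : ∀ (x y z : X) → x X.≈ y → x ⋖ z → y ⋖ z
  ⋖-respˡ x y z x≈y x⋖z = ⋖-intro y z (proj₁ x⋖z ∘ proj₂ x≈y)
    (≡.trans (⋖-dim x z x⋖z) (≡.cong suc (dimˣ-cong x y x≈y)))

  ⊑-antisym-dim : ∀ (y z : X) → proj₁ y ⊑ proj₁ z → dimˣ z ℕ.≤ dimˣ y → y X.≈ z
  ⊑-antisym-dim (y , _) (z , _) y⊑z dz≤dy = y⊑z , dim≤⇒⊒ y z y⊑z dz≤dy

  dim∧h≡0 : ∀ (y : X) → dim (proj₁ y ∧ h) ≡ 0
  dim∧h≡0 (y , triv) = trivial⇒dim≡0 y h triv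

  restrict : ∀ (y : X) z → z ⊑ proj₁ y → X
  restrict (y , triv) z z⊑y = z , λ { (v∈z , v∈h) → triv (z⊑y v∈z , v∈h) }

  -- Covers of an element inside a subspace

  cover? : ∀ (y : X) V (w : X) → Dec (y ⋖ w × proj₁ w ⊑ V)
  cover? y V w = (y ⋖? w) ×-dec (proj₁ w ≤? V)

  covers-within : X → Subspace → ℕ
  covers-within y V = #ˣ.count (cover? y V)

  module _ (y : X) (V : Subspace) (y⊑V : proj₁ y ⊑ V) where
    private
      y′ = proj₁ y
      T = y′ ∨ V ∧ h

      T⊑V : T ⊑ V
      T⊑V = ∨-least y′ (V ∧ h) V y⊑V (∧-lowerˡ V h)

      y⊑T : y′ ⊑ T
      y⊑T = ∨-upperˡ y′ (V ∧ h)

      ∈? : ∀ v w → Dec ((y ⋖ w × proj₁ w ⊑ V) × v ∈ Mem (proj₁ w))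
      ∈? v w = cover? y V w ×-dec mem? (proj₁ w) v

      -- Write `v` as `u + u′` with `u` in `y` and `u′` in `h`. Then `u′` also lies in `w`, which
      -- meets `h` trivially, so `v` is `u`.
      covers-∩T : ∀ w → y ⋖ w → proj₁ w ⊑ V → ∀ {v} → v ∈ Mem (proj₁ w) → v ∈ Mem T → v ∈ Mem y′
      covers-∩T (w , triv) (y⊑w , _) w⊑V {v} v∈w v∈T =
        let (u , u′ , u∈y , u′∈V∧h , eq) = ∈-∨⁻ y′ (V ∧ h) v∈T
            u′≈0 = triv (difference∈ w eq (y⊑w u∈y) v∈w , ∧-lowerʳ V h u′∈V∧h)
        in Subspace.resp y′
             (≈ᴹ-trans (≈ᴹ-sym (≈ᴹ-trans (+ᴹ-congˡ u′≈0) (+ᴹ-identityʳ u))) eq) u∈y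

      -- The only candidate is `y` plus the line of `v`: every cover containing `v` contains it and
      -- has the same dimension. What needs proof is that it meets `h` trivially.
      adjoin : ∀ {v} → v ∈ Mem V → v ∉ Mem T → ∃ λ w → y ⋖ w × proj₁ w ⊑ V × v ∈ Mem (proj₁ w) ×
               (∀ x → y ⋖ x → v ∈ Mem (proj₁ x) → x X.≈ w)
      adjoin {v} v∈V v∉T = wˣ , ⋖-intro y wˣ (⊑-span-∷ y′ v∉y) ≡.refl , w⊑V , ∈-span-∷ y′ v∉y
        , λ x y⋖x v∈x → X.sym {wˣ} {x} (⊑-antisym-dim wˣ x
            (⊑⇒span-∷⊑ y′ (proj₁ x) v∉y (proj₁ y⋖x) v∈x) (ℕₚ.≤-reflexive (⋖-dim y x y⋖x)))
        where
        v∉y : v ∉ Mem y′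
        v∉y = v∉T ∘ y⊑T
        w = span-∷ y′ v∉y
        w⊑V = ⊑⇒span-∷⊑ y′ V v∉y y⊑V v∈V

        -- If `t` were outside `y`, then `y` plus the line of `t` would be all of `w` by dimension
        -- and would contain `v`. But it lies in `T`, because `t` is in `V ∧ h`.
        trivial : ∀ t → t ∈ Mem w × t ∈ Mem h → t ≈ᴹ 0ᴹ
        trivial t (t∈w , t∈h) with mem? y′ t
        ... | yes t∈y = proj₂ y (t∈y , t∈h)
        ... | no t∉y  = contradiction
          (⊑⇒span-∷⊑ y′ T t∉y y⊑T (∨-upperʳ y′ (V ∧ h) (∈-∧⁺ V h (w⊑V t∈w) t∈h))
            (dim≤⇒⊒ (span-∷ y′ t∉y) w (⊑⇒span-∷⊑ y′ w t∉y (⊑-span-∷ y′ v∉y) t∈w) ℕₚ.≤-refl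
              (∈-span-∷ y′ v∉y)))
          v∉T

        wˣ : X
        wˣ = w , λ {t} → trivial t

      -- There are four cases: a vector of `y` is in every cover within `V`, a vector of `T` outside
      -- `y` in none, a vector of `V` outside `T` in exactly one, and a vector outside `V` in none.
      covers-containing : ∀ v → #ˣ.count (∈? v) ℕ.+ ⟦ mem? T v ⟧ ≡
                                covers-within y V ℕ.* ⟦ mem? y′ v ⟧ ℕ.+ ⟦ mem? V v ⟧
      covers-containing v with mem? y′ v
      ... | yes v∈y = ≡.cong₂ ℕ._+_
        (≡.trans (#ˣ.∑-cong (λ w → ⟦⟧-⇔ (∈? v w) (cover? y V w) proj₁
                                    (λ { w@((y⊑w , _) , _) → w , y⊑w v∈y })))
                 (≡.sym (ℕₚ.*-identityʳ _)))
        (≡.trans (⟦⟧-true (mem? T v) (y⊑T v∈y)) (≡.sym (⟦⟧-true (mem? V v) (y⊑V v∈y))))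
      ... | no v∉y = ≡.trans outside (≡.cong (ℕ._+ ⟦ mem? V v ⟧) (≡.sym (ℕₚ.*-zeroʳ (covers-within y V))))
        where
        outside : #ˣ.count (∈? v) ℕ.+ ⟦ mem? T v ⟧ ≡ ⟦ mem? V v ⟧
        outside with mem? T v
        ... | yes v∈T = ≡.trans
          (≡.cong (ℕ._+ 1) (#ˣ.count-empty (∈? v)
            (λ { w ((y⋖w , w⊑V) , v∈w) → v∉y (covers-∩T w y⋖w w⊑V v∈w v∈T) })))
          (≡.sym (⟦⟧-true (mem? V v) (T⊑V v∈T)))
        ... | no v∉T = ≡.trans (ℕₚ.+-identityʳ _) (⟦⟧-split (mem? V v) _
          (λ v∈V → let (w , y⋖w , w⊑V , v∈w , unique) = adjoin v∈V v∉T in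
            #ˣ.count-unique (∈? v)
              (λ { {x} {z} x≈z ((y⋖x , x⊑V) , v∈x) →
                     (⋖-respʳ y x z x≈z y⋖x , x⊑V ∘ proj₂ x≈z) , proj₁ x≈z v∈x })
              w ((y⋖w , w⊑V) , v∈w)
              (λ { {x} ((y⋖x , _) , v∈x) → unique x y⋖x v∈x }))
          (λ v∉V → #ˣ.count-empty (∈? v) (λ { w ((_ , w⊑V) , v∈w) → v∉V (w⊑V v∈w) })))

      q^ : ℕ → ℕ
      q^ = q ℕ.^_

      -- Sums `covers-containing` over all vectors. The pairs of a cover and a vector in it number
      -- `q ^ (dim y + 1)` for each cover.
      covers-within-eq : covers-within y V ℕ.* q^ (suc (dimˣ y)) ℕ.+ q^ (dim T) ≡
                         covers-within y V ℕ.* q^ (dimˣ y) ℕ.+ q^ (dim V)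
      covers-within-eq = begin
        k ℕ.* q^ (suc (dimˣ y)) ℕ.+ q^ (dim T)
          ≡⟨ ≡.cong₂ ℕ._+_ incidences (≡.sym (card≡q^dim T)) ⟩
        #ᴴ.∑ (λ v → #ˣ.count (∈? v)) ℕ.+ #ᴴ.count (mem? T)
          ≡⟨ #ᴴ.∑-distrib _ _ ⟨
        #ᴴ.∑ (λ v → #ˣ.count (∈? v) ℕ.+ ⟦ mem? T v ⟧)
          ≡⟨ #ᴴ.∑-cong covers-containing ⟩
        #ᴴ.∑ (λ v → k ℕ.* ⟦ mem? y′ v ⟧ ℕ.+ ⟦ mem? V v ⟧)
          ≡⟨ #ᴴ.∑-distrib _ _ ⟩
        #ᴴ.∑ (λ v → k ℕ.* ⟦ mem? y′ v ⟧) ℕ.+ #ᴴ.count (mem? V)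
          ≡⟨ ≡.cong₂ ℕ._+_ (≡.trans (#ᴴ.∑-*ˡ k _) (≡.cong (k ℕ.*_) (card≡q^dim y′))) (card≡q^dim V) ⟩
        k ℕ.* q^ (dimˣ y) ℕ.+ q^ (dim V)  ∎
        where
        open ≡.≡-Reasoning
        k = covers-within y V

        incidences : k ℕ.* q^ (suc (dimˣ y)) ≡ #ᴴ.∑ (λ v → #ˣ.count (∈? v))
        incidences = begin
          k ℕ.* q^ (suc (dimˣ y))
            ≡⟨ #ˣ.∑-*ʳ (λ w → ⟦ cover? y V w ⟧) (q^ (suc (dimˣ y))) ⟨
          #ˣ.∑ (λ w → ⟦ cover? y V w ⟧ ℕ.* q^ (suc (dimˣ y)))
            ≡⟨ #ˣ.∑-cong (λ w → ⟦⟧-*-cong (cover? y V w) (λ { (y⋖w , _) →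
                 ≡.trans (≡.cong q^ (≡.sym (⋖-dim y w y⋖w))) (≡.sym (card≡q^dim (proj₁ w))) })) ⟩
          #ˣ.∑ (λ w → ⟦ cover? y V w ⟧ ℕ.* #ᴴ.count (mem? (proj₁ w)))
            ≡⟨ #ˣ.∑-cong (λ w → ≡.trans (≡.sym (#ᴴ.∑-*ˡ ⟦ cover? y V w ⟧ _))
                 (#ᴴ.∑-cong (λ v → ≡.sym (⟦⟧-× (cover? y V w) (mem? (proj₁ w) v))))) ⟩
          #ˣ.∑ (λ w → #ᴴ.count (λ v → ∈? v w))
            ≡⟨ double-counting X-size H-size (λ w v → ⟦ ∈? v w ⟧) ⟩
          #ᴴ.∑ (λ v → #ˣ.count (∈? v)) ∎

      dim-T : dim T ≡ dimˣ y ℕ.+ dim (V ∧ h)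
      dim-T = begin
        dim T                                ≡⟨ ℕₚ.+-identityʳ _ ⟨
        dim T ℕ.+ 0                          ≡⟨ ≡.cong (dim T ℕ.+_) (ℕₚ.n≤0⇒n≡0 y∧T≤0) ⟨
        dim T ℕ.+ dim (y′ ∧ V ∧ h)           ≡⟨ dim-∨-∧ y′ (V ∧ h) ⟩
        dimˣ y ℕ.+ dim (V ∧ h)               ∎
        where
        open ≡.≡-Reasoning

        y∧T≤0 : dim (y′ ∧ V ∧ h) ℕ.≤ 0
        y∧T≤0 = ℕₚ.≤-trans
          (dim-mono {y′ ∧ V ∧ h} {y′ ∧ h} (∧-greatest (y′ ∧ V ∧ h) y′ h (∧-lowerˡ y′ (V ∧ h))
            (∧-lowerʳ V h ∘ ∧-lowerʳ y′ (V ∧ h))))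
          (ℕₚ.≤-reflexive (dim∧h≡0 y))

    -- This is `covers-within-eq` divided by `q ^ dim y`. With `t = dim (V ∧ h)` it says that the
    -- number of covers is `(q ^ d - q ^ t) / (q - 1)`, in the form that `affine-unique` takes.
    covers-within-dim : ∀ d → dim V ≡ dimˣ y ℕ.+ d →
                        covers-within y V ℕ.* q ℕ.+ q ℕ.^ dim (V ∧ h) ≡ covers-within y V ℕ.+ q ℕ.^ d
    covers-within-dim d dim-V = ℕₚ.*-cancelˡ-≡ _ _ (q^ i) {{ℕₚ.m^n≢0 q i {{q-nonZero}}}} (begin
      q^ i ℕ.* (k ℕ.* q ℕ.+ q^ t)          ≡⟨ rearrange₁ (q^ i) k q (q^ t) ⟩
      k ℕ.* q^ (suc i) ℕ.+ q^ i ℕ.* q^ t   ≡⟨ ≡.cong (k ℕ.* q^ (suc i) ℕ.+_) (ℕₚ.^-distribˡ-+-* q i t) ⟨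
      k ℕ.* q^ (suc i) ℕ.+ q^ (i ℕ.+ t)    ≡⟨ ≡.cong (λ s → k ℕ.* q^ (suc i) ℕ.+ q^ s) dim-T ⟨
      k ℕ.* q^ (suc i) ℕ.+ q^ (dim T)      ≡⟨ covers-within-eq ⟩
      k ℕ.* q^ i ℕ.+ q^ (dim V)            ≡⟨ ≡.cong (λ s → k ℕ.* q^ i ℕ.+ q^ s) dim-V ⟩
      k ℕ.* q^ i ℕ.+ q^ (i ℕ.+ d)          ≡⟨ ≡.cong (k ℕ.* q^ i ℕ.+_) (ℕₚ.^-distribˡ-+-* q i d) ⟩
      k ℕ.* q^ i ℕ.+ q^ i ℕ.* q^ d         ≡⟨ rearrange₂ (q^ i) k (q^ d) ⟩
      q^ i ℕ.* (k ℕ.+ q^ d)                ∎)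
      where
      open ≡.≡-Reasoning
      i = dimˣ y
      k = covers-within y V
      t = dim (V ∧ h)

      rearrange₁ : ∀ x k q z → x ℕ.* (k ℕ.* q ℕ.+ z) ≡ k ℕ.* (q ℕ.* x) ℕ.+ x ℕ.* z
      rearrange₁ = solve-∀

      rearrange₂ : ∀ x k z → k ℕ.* x ℕ.+ x ℕ.* z ≡ x ℕ.* (k ℕ.+ z)
      rearrange₂ = solve-∀

  -- Intervals and common lower covers

  between? : ∀ (y z w : X) → Dec (y ⋖ w × w ⋖ z)
  between? y z w = (y ⋖? w) ×-dec (w ⋖? z)

  meet? : ∀ (y z w : X) → Dec (w ⋖ y × w ⋖ z)
  meet? y z w = (w ⋖? y) ×-dec (w ⋖? z)

  meets : X → X → ℕ
  meets y z = #ˣ.count (meet? y z)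

  -- The middle elements are the covers of `y` within `z`. As `z` meets `h` trivially, their number
  -- solves `k * q + 1 = k + q ^ 2`, and so does `q + 1`.
  between-count : ∀ (y z : X) → dimˣ z ≡ suc (suc (dimˣ y)) →
                  #ˣ.count (between? y z) ≡ suc q ℕ.* ⟦ proj₁ y ≤? proj₁ z ⟧
  between-count y z dim-z with proj₁ y ≤? proj₁ z
  ... | no y⋢z = ≡.trans
    (#ˣ.count-empty (between? y z) (λ { w (y⋖w , w⋖z) → y⋢z (proj₁ w⋖z ∘ proj₁ y⋖w) }))
    (≡.sym (ℕₚ.*-zeroʳ (suc q)))
  ... | yes y⊑z = ≡.trans
    (#ˣ.∑-cong (λ w → ⟦⟧-⇔ (between? y z w) (cover? y (proj₁ z) w)
      (λ { (y⋖w , w⋖z) → y⋖w , proj₁ w⋖z })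
      (λ { (y⋖w , w⊑z) → y⋖w , ⋖-intro w z w⊑z (≡.trans dim-z (≡.cong suc (≡.sym (⋖-dim y w y⋖w)))) })))
    (≡.trans (affine-unique 1<q {x = 1} {z = q ℕ.^ 2}
      (≡.trans (≡.cong (λ t → covers-within y (proj₁ z) ℕ.* q ℕ.+ q ℕ.^ t) (≡.sym (dim∧h≡0 z)))
        (covers-within-dim y (proj₁ z) y⊑z 2 (≡.trans dim-z (ℕₚ.+-comm 2 (dimˣ y)))))
      (poly q)) (≡.sym (ℕₚ.*-identityʳ (suc q))))
    where
    poly : ∀ q → suc q ℕ.* q ℕ.+ 1 ≡ suc q ℕ.+ q ℕ.* (q ℕ.* 1)
    poly = solve-∀

  -- A common lower cover lies in `y ∧ z` and has the same dimension, so it is `y ∧ z`, which is in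
  -- `X` because it lies in `y`.
  meets-unique : ∀ (y z : X) → suc (dim (proj₁ y ∧ proj₁ z)) ≡ dimˣ y → suc (dim (proj₁ y ∧ proj₁ z)) ≡ dimˣ z →
                 meets y z ≡ 1
  meets-unique y z dim-y dim-z = #ˣ.count-unique (meet? y z)
    (λ { {x} {w} x≈w (x⋖y , x⋖z) → ⋖-respˡ x w y x≈w x⋖y , ⋖-respˡ x w z x≈w x⋖z })
    y∧z (⋖-intro y∧z y (∧-lowerˡ _ _) (≡.sym dim-y) , ⋖-intro y∧z z (∧-lowerʳ _ _) (≡.sym dim-z))
    (λ { {x} (x⋖y , x⋖z) → ⊑-antisym-dim x y∧z (∧-greatest (proj₁ x) (proj₁ y) (proj₁ z) (proj₁ x⋖y) (proj₁ x⋖z))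
           (ℕₚ.≤-reflexive (ℕₚ.suc-injective (≡.trans dim-y (⋖-dim x y x⋖y)))) })
    where
    y∧z : X
    y∧z = restrict y (proj₁ y ∧ proj₁ z) (∧-lowerˡ (proj₁ y) (proj₁ z))

  ⋢⇒dim< : ∀ y w → ¬ w ⊑ y → dim y ℕ.< dim (y ∨ w)
  ⋢⇒dim< y w w⋢y = ℕₚ.≰⇒> (λ d≤ → w⋢y
    (dim≤⇒⊒ y (y ∨ w) (∨-upperˡ y w) d≤ ∘ ∨-upperʳ y w))

  module _ (y w z : Subspace) (w⋢y : ¬ w ⊑ y) (y⊑z : y ⊑ z) (w⊑z : w ⊑ z) (dim-z : dim z ≡ suc (dim y)) where

    -- `y` is a hyperplane of `z` that does not contain `w`, so `y ∨ w` is strictly larger than `y`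
    -- and fills `z`.
    hyperplane-join : z ⊑ y ∨ w
    hyperplane-join = dim≤⇒⊒ (y ∨ w) z (∨-least y w z y⊑z w⊑z)
      (≡.subst (ℕ._≤ dim (y ∨ w)) (≡.sym dim-z) (⋢⇒dim< y w w⋢y))

    -- The join has dimension `suc (dim y)`, so by the modular law `y` cuts `w` in a hyperplane of
    -- `w`.
    hyperplane-meet : suc (dim (y ∧ w)) ≡ dim w
    hyperplane-meet = ℕₚ.+-cancelˡ-≡ (dim y) _ _ (begin
      dim y ℕ.+ suc (dim (y ∧ w))       ≡⟨ ℕₚ.+-suc (dim y) (dim (y ∧ w)) ⟩
      suc (dim y) ℕ.+ dim (y ∧ w)       ≡⟨ ≡.cong (ℕ._+ dim (y ∧ w)) dim-z ⟨
      dim z ℕ.+ dim (y ∧ w)             ≡⟨ ≡.cong (ℕ._+ dim (y ∧ w)) (dim-cong {z} {y ∨ w}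
                                             (hyperplane-join , ∨-least y w z y⊑z w⊑z)) ⟩
      dim (y ∨ w) ℕ.+ dim (y ∧ w)       ≡⟨ dim-∨-∧ y w ⟩
      dim y ℕ.+ dim w                   ∎)
      where open ≡.≡-Reasoning

  meets-below : ∀ (y w z : X) → y ⋖ z → w ⋖ z → ¬ w X.≈ y → meets y w ≡ 1
  meets-below y w z y⋖z w⋖z w≉y = meets-unique y w (≡.trans meet-dim (≡.sym dim-y≡w)) meet-dim
    where
    dim-y≡w : dimˣ y ≡ dimˣ w
    dim-y≡w = ℕₚ.suc-injective (≡.trans (≡.sym (⋖-dim y z y⋖z)) (⋖-dim w z w⋖z))

    meet-dim : suc (dim (proj₁ y ∧ proj₁ w)) ≡ dimˣ w
    meet-dim = hyperplane-meet (proj₁ y) (proj₁ w) (proj₁ z)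
      (λ w⊑y → w≉y (⊑-antisym-dim w y w⊑y (ℕₚ.≤-reflexive dim-y≡w)))
      (proj₁ y⋖z) (proj₁ w⋖z) (⋖-dim y z y⋖z)

  -- The meet of `z` and `w` contains `y`. Were it larger, it would be all of `w`, so `w` would lie
  -- in `z` and equal it by dimension.
  meets-above : ∀ (y z w : X) → y ⋖ z → y ⋖ w → ¬ w X.≈ z → meets z w ≡ 1
  meets-above y z w y⋖z y⋖w w≉z = meets-unique z w
    (≡.trans (≡.cong suc meet-dim) (≡.sym (⋖-dim y z y⋖z)))
    (≡.trans (≡.cong suc meet-dim) (≡.sym (⋖-dim y w y⋖w)))
    where
    z∧w = proj₁ z ∧ proj₁ w

    meet-dim : dim z∧w ≡ dimˣ y
    meet-dim = ℕₚ.≤-antisym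
      (ℕₚ.≮⇒≥ (λ dy<dm → w≉z (⊑-antisym-dim w z
        (∧-lowerˡ _ _ ∘ dim≤⇒⊒ z∧w (proj₁ w) (∧-lowerʳ (proj₁ z) (proj₁ w))
          (≡.subst (ℕ._≤ dim z∧w) (≡.sym (⋖-dim y w y⋖w)) dy<dm))
        (ℕₚ.≤-reflexive (≡.trans (⋖-dim y z y⋖z) (≡.sym (⋖-dim y w y⋖w)))))))
      (dim-mono {proj₁ y} {z∧w} (∧-greatest (proj₁ y) (proj₁ z) (proj₁ w) (proj₁ y⋖z) (proj₁ y⋖w)))

  meets-cong : ∀ (z : X) {w x : X} → w X.≈ x → meets z w ≡ meets z x
  meets-cong z {w} {x} w≈x = #ˣ.∑-cong (λ u → ⟦⟧-⇔ (meet? z w u) (meet? z x u)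
    (λ { (u⋖z , u⋖w) → u⋖z , ⋖-respʳ u w x w≈x u⋖w })
    (λ { (u⋖z , u⋖x) → u⋖z , ⋖-respʳ u x w (X.sym {w} {x} w≈x) u⋖x }))

  meets-comm : ∀ (y z : X) → meets y z ≡ meets z y
  meets-comm y z = #ˣ.∑-cong (λ w → ⟦⟧-⇔ (meet? y z w) (meet? z y w) swap swap)

  meets-self : ∀ (y : X) → meets y y ≡ #ˣ.count (_⋖? y)
  meets-self y = #ˣ.∑-cong (λ w → ⟦⟧-⇔ (meet? y y w) (w ⋖? y) proj₁ (λ w⋖y → w⋖y , w⋖y))

  -- Three-step paths

  upper? : ∀ (y z w : X) → Dec (z ⋖ w × proj₁ y ⊑ proj₁ w)
  upper? y z w = (z ⋖? w) ×-dec (proj₁ y ≤? proj₁ w)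

  lower? : ∀ (y z w : X) → Dec (w ⋖ y × proj₁ w ⊑ proj₁ z)
  lower? y z w = (w ⋖? y) ×-dec (proj₁ w ≤? proj₁ z)

  between : X → X → ℕ
  between y z = #ˣ.count (between? y z)

  -- Paths from `y` to `z`, grouped by one vertex: the one above `z`, the one above `y` and the one
  -- below `y` respectively. `between` and `meets` count the choices of the other vertex.
  up-up-down up-down-up down-up-up : X → X → ℕ
  up-up-down y z = #ˣ.∑ (λ w → ⟦ z ⋖? w ⟧ ℕ.* between y w)
  up-down-up y z = #ˣ.∑ (λ w → ⟦ y ⋖? w ⟧ ℕ.* meets z w)
  down-up-up y z = #ˣ.∑ (λ w → ⟦ w ⋖? y ⟧ ℕ.* between w z)

  private
    between-sum : ∀ {A B : X → Set (c ⊔ m ⊔ ℓm)} (A? : Unary.Decidable A) (B? : Unary.Decidable B) (f : X → ℕ) →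
                  (∀ w → A w → f w ≡ suc q ℕ.* ⟦ B? w ⟧) →
                  #ˣ.∑ (λ w → ⟦ A? w ⟧ ℕ.* f w) ≡ suc q ℕ.* #ˣ.count (λ w → A? w ×-dec B? w)
    between-sum A? B? f f≡ = ≡.trans
      (#ˣ.∑-cong (λ w → ≡.trans (⟦⟧-*-cong (A? w) (f≡ w))
        (≡.trans (commute ⟦ A? w ⟧ (suc q) ⟦ B? w ⟧)
                 (≡.cong (suc q ℕ.*_) (≡.sym (⟦⟧-× (A? w) (B? w)))))))
      (#ˣ.∑-*ˡ (suc q) (λ w → ⟦ A? w ×-dec B? w ⟧))
      where
      commute : ∀ a b c → a ℕ.* (b ℕ.* c) ≡ b ℕ.* (a ℕ.* c)
      commute = solve-∀

  -- Each `w` above `z` is two dimensions above `y`, so it contributes a full interval of `q + 1`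
  -- middle elements if it contains `y`, and nothing otherwise.
  up-up-down≡upper : ∀ (y z : X) → dimˣ z ≡ suc (dimˣ y) → up-up-down y z ≡ suc q ℕ.* #ˣ.count (upper? y z)
  up-up-down≡upper y z dim-z = between-sum (z ⋖?_) (λ w → proj₁ y ≤? proj₁ w) (between y)
    (λ w z⋖w → between-count y w (≡.trans (⋖-dim z w z⋖w) (≡.cong suc dim-z)))

  down-up-up≡lower : ∀ (y z : X) → dimˣ z ≡ suc (dimˣ y) → down-up-up y z ≡ suc q ℕ.* #ˣ.count (lower? y z)
  down-up-up≡lower y z dim-z = between-sum (_⋖? y) (λ w → proj₁ w ≤? proj₁ z) (λ w → between w z)
    (λ w w⋖y → between-count w z (≡.trans dim-z (≡.cong suc (⋖-dim w y w⋖y))))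

  -- The same paths, grouped on the left by the vertex below `z` and on the right by the vertex
  -- below `y`.
  down-up-up-meets : ∀ (y z : X) → #ˣ.∑ (λ w → ⟦ w ⋖? z ⟧ ℕ.* meets y w) ≡ down-up-up y z
  down-up-up-meets y z = begin
    #ˣ.∑ (λ w → ⟦ w ⋖? z ⟧ ℕ.* meets y w)
      ≡⟨ #ˣ.∑-cong (λ w → ≡.trans (≡.sym (#ˣ.∑-*ˡ ⟦ w ⋖? z ⟧ _)) (#ˣ.∑-cong (λ x →
           ≡.trans (≡.cong (⟦ w ⋖? z ⟧ ℕ.*_) (⟦⟧-× (x ⋖? y) (x ⋖? w)))
           (≡.trans (rotate ⟦ w ⋖? z ⟧ ⟦ x ⋖? y ⟧ ⟦ x ⋖? w ⟧)
                    (≡.cong (⟦ x ⋖? y ⟧ ℕ.*_) (≡.sym (⟦⟧-× (x ⋖? w) (w ⋖? z)))))))) ⟩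
    #ˣ.∑ (λ w → #ˣ.∑ (λ x → ⟦ x ⋖? y ⟧ ℕ.* ⟦ between? x z w ⟧))
      ≡⟨ double-counting X-size X-size (λ w x → ⟦ x ⋖? y ⟧ ℕ.* ⟦ between? x z w ⟧) ⟩
    #ˣ.∑ (λ x → #ˣ.∑ (λ w → ⟦ x ⋖? y ⟧ ℕ.* ⟦ between? x z w ⟧))
      ≡⟨ #ˣ.∑-cong (λ x → #ˣ.∑-*ˡ ⟦ x ⋖? y ⟧ _) ⟩
    down-up-up y z ∎
    where
    open ≡.≡-Reasoning

    rotate : ∀ a b c → a ℕ.* (b ℕ.* c) ≡ b ℕ.* (c ℕ.* a)
    rotate = solve-∀

  -- The path identity, where `d` is the codimension of `z`

  module _ (y z : X) (dim-z : dimˣ z ≡ suc (dimˣ y)) (d : ℕ) (dim-H : n ≡ dimˣ z ℕ.+ d) where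
    private
      α = #ˣ.count (upper? y z)
      ε = #ˣ.count (lower? y z)
      q^ = q ℕ.^_

    -- A cover of `y` other than `z` has only `y` as common lower cover with `z`, while `z` itself
    -- contributes all its `A` lower covers. So there are `ky + A - 1` paths up-down-up, and it
    -- remains to express `ky` by `kz` and `A` by `B`.
    path-identity-⋖ : y ⋖ z → α ℕ.+ q ℕ.* ε ℕ.+ q^ d ≡ up-down-up y z
    path-identity-⋖ y⋖z@(y⊑z , _) = ℕₚ.+-cancelʳ-≡ 1 _ _ (begin
      α ℕ.+ q ℕ.* ε ℕ.+ q^ d ℕ.+ 1     ≡⟨ ≡.cong₂ (λ a e → a ℕ.+ q ℕ.* e ℕ.+ q^ d ℕ.+ 1) α≡ ε≡ ⟩
      kz ℕ.+ q ℕ.* B ℕ.+ q^ d ℕ.+ 1    ≡⟨ rearrange kz (q ℕ.* B) (q^ d) ⟩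
      (kz ℕ.+ q^ d) ℕ.+ (q ℕ.* B ℕ.+ 1)  ≡⟨ ≡.cong₂ ℕ._+_ ky≡ A≡ ⟨
      ky ℕ.+ A                         ≡⟨ ≡.cong₂ ℕ._+_ ky-count (≡.sym (meets-self z)) ⟩
      #ˣ.count (y ⋖?_) ℕ.+ meets z z   ≡⟨ #ˣ.∑-exceptional (y ⋖?_) _≈?_ (λ {w} {x} → ⋖-respʳ y w x)
                                            (λ {w} {x} → meets-cong z {w} {x}) z y⋖z (λ w → meets-above y z w y⋖z) ⟨
      up-down-up y z ℕ.+ 1                ∎)
      where
      open ≡.≡-Reasoning
      A = #ˣ.count (_⋖? z)
      B = #ˣ.count (_⋖? y)
      kz = covers-within z full
      ky = covers-within y full

      rearrange : ∀ a b c → a ℕ.+ b ℕ.+ c ℕ.+ 1 ≡ (a ℕ.+ c) ℕ.+ (b ℕ.+ 1)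
      rearrange = solve-∀

      ky-count : ky ≡ #ˣ.count (y ⋖?_)
      ky-count = #ˣ.∑-cong (λ w → ⟦⟧-⇔ (cover? y full w) (y ⋖? w) proj₁ (_, ⊑-full (proj₁ w)))

      α≡ : α ≡ kz
      α≡ = #ˣ.∑-cong (λ w → ⟦⟧-⇔ (upper? y z w) (cover? z full w)
        (λ { (z⋖w , _) → z⋖w , ⊑-full (proj₁ w) }) (λ { (z⋖w , _) → z⋖w , proj₁ z⋖w ∘ y⊑z }))

      ε≡ : ε ≡ B
      ε≡ = #ˣ.∑-cong (λ w → ⟦⟧-⇔ (lower? y z w) (w ⋖? y) proj₁ (λ w⋖y → w⋖y , y⊑z ∘ proj₁ w⋖y))

      -- Counts the paths down-up-up from `y` to `z` twice: grouped by the vertex below `z` there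
      -- are `A + B - 1`, grouped by the vertex below `y` there are `(q + 1) * B`.
      A≡ : A ≡ q ℕ.* B ℕ.+ 1
      A≡ = ℕₚ.+-cancelʳ-≡ B _ _ (begin
        A ℕ.+ B                        ≡⟨ ≡.cong (A ℕ.+_) (meets-self y) ⟨
        A ℕ.+ meets y y                ≡⟨ #ˣ.∑-exceptional (_⋖? z) _≈?_ (λ {w} {x} → ⋖-respˡ w x z)
                                            (λ {w} {x} → meets-cong y {w} {x}) y y⋖z
                                            (λ w → meets-below y w z y⋖z) ⟨
        #ˣ.∑ (λ w → ⟦ w ⋖? z ⟧ ℕ.* meets y w) ℕ.+ 1
                                       ≡⟨ ≡.cong (ℕ._+ 1) (≡.trans (down-up-up-meets y z) (down-up-up≡lower y z dim-z)) ⟩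
        suc q ℕ.* ε ℕ.+ 1              ≡⟨ ≡.cong (λ e → suc q ℕ.* e ℕ.+ 1) ε≡ ⟩
        suc q ℕ.* B ℕ.+ 1              ≡⟨ poly q B ⟩
        (q ℕ.* B ℕ.+ 1) ℕ.+ B          ∎)
        where
        poly : ∀ q b → suc q ℕ.* b ℕ.+ 1 ≡ (q ℕ.* b ℕ.+ 1) ℕ.+ b
        poly = solve-∀

      -- Inside `H` the cover equations of `y` and `z` share the term `q ^ t` and differ only in the
      -- exponents `d + 1` and `d`. Hence `kz + q ^ d` solves the one for `y`.
      ky≡ : ky ≡ kz ℕ.+ q^ d
      ky≡ = affine-unique 1<q {x = q^ t} {z = q^ (suc d)}
        (covers-within-dim y full (⊑-full (proj₁ y)) (suc d)
          (≡.trans dim-H (≡.trans (≡.cong (ℕ._+ d) dim-z) (≡.sym (ℕₚ.+-suc (dimˣ y) d)))))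
        (begin
          (kz ℕ.+ q^ d) ℕ.* q ℕ.+ q^ t            ≡⟨ poly₁ kz (q^ d) q (q^ t) ⟩
          (kz ℕ.* q ℕ.+ q^ t) ℕ.+ q^ (suc d)      ≡⟨ ≡.cong (ℕ._+ q^ (suc d))
                                                       (covers-within-dim z full (⊑-full (proj₁ z)) d dim-H) ⟩
          (kz ℕ.+ q^ d) ℕ.+ q^ (suc d)            ∎)
        where
        t = dim (full ∧ h)
        poly₁ : ∀ k x q t → (k ℕ.+ x) ℕ.* q ℕ.+ t ≡ (k ℕ.* q ℕ.+ t) ℕ.+ q ℕ.* x
        poly₁ = solve-∀

    module _ (y⋢z : ¬ proj₁ y ⊑ proj₁ z) where
      private
        y′ = proj₁ y
        z′ = proj₁ z
        p = z′ ∧ y′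
        s = z′ ∨ y′

        ⋖z⇒dim : ∀ x → x ⋖ z → dimˣ x ≡ dimˣ y
        ⋖z⇒dim x x⋖z = ℕₚ.suc-injective (≡.trans (≡.sym (⋖-dim x z x⋖z)) dim-z)

        ⋖z⇒⋢y : ∀ (x : X) → x ⋖ z → ¬ proj₁ x ⊑ y′
        ⋖z⇒⋢y x x⋖z x⊑y = y⋢z (proj₁ x⋖z ∘ dim≤⇒⊒ (proj₁ x) y′ x⊑y
          (ℕₚ.≤-reflexive (≡.sym (⋖z⇒dim x x⋖z))))

      -- Any upper bound counted by `α`, lower bound counted by `ε` or path up-down-up would make
      -- `p` a hyperplane of `y`, so all three counts vanish.
      path-identity-far : suc (dim p) ≢ dimˣ y → α ℕ.+ q ℕ.* ε ≡ up-down-up y z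
      path-identity-far far = begin
        α ℕ.+ q ℕ.* ε   ≡⟨ ≡.cong₂ (λ a e → a ℕ.+ q ℕ.* e) α≡0 ε≡0 ⟩
        0 ℕ.+ q ℕ.* 0   ≡⟨ ℕₚ.*-zeroʳ q ⟩
        0               ≡⟨ #ˣ.∑-zero (λ w → ≡.trans (⟦⟧-*-cong (y ⋖? w) (no-meets w)) (ℕₚ.*-zeroʳ ⟦ y ⋖? w ⟧)) ⟨
        up-down-up y z     ∎
        where
        open ≡.≡-Reasoning

        p<y : dim p ℕ.< dimˣ y
        p<y = ℕₚ.≰⇒> (λ y≤p → y⋢z (∧-lowerˡ z′ y′ ∘ dim≤⇒⊒ p y′ (∧-lowerʳ z′ y′) y≤p))

        below-p : ∀ x → x ⊑ p → dimˣ y ≢ suc (dim x)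
        below-p x x⊑p eq = far (ℕₚ.≤-antisym p<y
          (≡.subst (ℕ._≤ suc (dim p)) (≡.sym eq) (ℕ.s≤s (dim-mono {x} {p} x⊑p))))

        α≡0 : α ≡ 0
        α≡0 = #ˣ.count-empty (upper? y z) (λ { w (z⋖w , y⊑w) →
          far (hyperplane-meet z′ y′ (proj₁ w) y⋢z (proj₁ z⋖w) y⊑w (⋖-dim z w z⋖w)) })

        ε≡0 : ε ≡ 0
        ε≡0 = #ˣ.count-empty (lower? y z) (λ { w (w⋖y , w⊑z) →
          below-p (proj₁ w) (∧-greatest (proj₁ w) z′ y′ w⊑z (proj₁ w⋖y)) (⋖-dim w y w⋖y) })

        -- If `x` is below both `z` and `w`, then `x` and `y` are distinct hyperplanes of `w`. Their
        -- meet has codimension one in both and lies in `p`.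
        no-meets : ∀ w → y ⋖ w → meets z w ≡ 0
        no-meets w y⋖w = #ˣ.count-empty (meet? z w) (λ { x (x⋖z , x⋖w) →
             below-p (y′ ∧ proj₁ x)
               (∧-greatest (y′ ∧ proj₁ x) z′ y′ (proj₁ x⋖z ∘ ∧-lowerʳ y′ (proj₁ x)) (∧-lowerˡ y′ (proj₁ x)))
               (≡.trans (≡.sym (⋖z⇒dim x x⋖z)) (≡.sym (hyperplane-meet y′ (proj₁ x) (proj₁ w) (⋖z⇒⋢y x x⋖z)
                 (proj₁ y⋖w) (proj₁ x⋖w) (⋖-dim y w y⋖w)))) })

      module _ (near : suc (dim p) ≡ dimˣ y) where
        private
          k = covers-within y s
          t = dim (s ∧ h)

          dim-s : dim s ≡ suc (dimˣ z)
          dim-s = ℕₚ.+-cancelʳ-≡ (dim p) _ _ (begin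
            dim s ℕ.+ dim p           ≡⟨ dim-∨-∧ z′ y′ ⟩
            dimˣ z ℕ.+ dimˣ y         ≡⟨ ≡.cong (dimˣ z ℕ.+_) near ⟨
            dimˣ z ℕ.+ suc (dim p)    ≡⟨ ℕₚ.+-suc (dimˣ z) (dim p) ⟩
            suc (dimˣ z) ℕ.+ dim p    ∎)
            where open ≡.≡-Reasoning

          k-equation : k ℕ.* q ℕ.+ q^ t ≡ k ℕ.+ q^ 2
          k-equation = covers-within-dim y s (∨-upperʳ z′ y′) 2
            (≡.trans dim-s (≡.trans (≡.cong suc dim-z) (ℕₚ.+-comm 2 (dimˣ y))))

          -- If `w` lies in `s`, then the hyperplane `z` of `s` cuts it in a common hyperplane of
          -- `z` and `w`. Conversely, a common lower cover `x` gives `w` as the join of `y` and `x`,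
          -- both of which lie in `s`.
          meets-near : ∀ w → y ⋖ w → meets z w ≡ ⟦ proj₁ w ≤? s ⟧
          meets-near w y⋖w = ⟦⟧-split (proj₁ w ≤? s) (meets z w)
            (λ w⊑s → let meet-dim = hyperplane-meet z′ (proj₁ w) s (λ w⊑z → y⋢z (w⊑z ∘ proj₁ y⋖w))
                                      (∨-upperˡ z′ y′) w⊑s dim-s
                     in meets-unique z w
                          (≡.trans meet-dim (≡.trans (⋖-dim y w y⋖w) (≡.sym dim-z))) meet-dim)
            (λ w⋢s → #ˣ.count-empty (meet? z w) (λ { x (x⋖z , x⋖w) →
              w⋢s (∨-least y′ (proj₁ x) s (∨-upperʳ z′ y′) (∨-upperˡ z′ y′ ∘ proj₁ x⋖z)
                  ∘ hyperplane-join y′ (proj₁ x) (proj₁ w) (⋖z⇒⋢y x x⋖z)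
                      (proj₁ y⋖w) (proj₁ x⋖w) (⋖-dim y w y⋖w)) }))

          up-down-up≡k : up-down-up y z ≡ k
          up-down-up≡k = #ˣ.∑-cong (λ w → ≡.trans (⟦⟧-*-cong (y ⋖? w) (meets-near w))
            (≡.sym (⟦⟧-× (y ⋖? w) (proj₁ w ≤? s))))

          ε≡1 : ε ≡ 1
          ε≡1 = #ˣ.count-unique (lower? y z)
            (λ { {w} {x} w≈x (w⋖y , w⊑z) → ⋖-respˡ w x y w≈x w⋖y , w⊑z ∘ proj₂ w≈x })
            pˣ (⋖-intro pˣ y (∧-lowerʳ z′ y′) (≡.sym near) , ∧-lowerˡ z′ y′)
            (λ { {w} (w⋖y , w⊑z) → ⊑-antisym-dim w pˣ (∧-greatest (proj₁ w) z′ y′ w⊑z (proj₁ w⋖y))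
                   (ℕₚ.≤-reflexive (ℕₚ.suc-injective (≡.trans near (⋖-dim w y w⋖y)))) })
            where
            pˣ : X
            pˣ = restrict y p (∧-lowerʳ z′ y′)

          -- A cover of `z` containing `y` contains the join `s` and has its dimension, so only `s`
          -- itself qualifies; `t ≡ 0` puts `s` in `X`.
          α≡1 : t ≡ 0 → α ≡ 1
          α≡1 t≡0 = #ˣ.count-unique (upper? y z)
            (λ { {w} {x} w≈x (z⋖w , y⊑w) → ⋖-respʳ z w x w≈x z⋖w , proj₁ w≈x ∘ y⊑w })
            sˣ (⋖-intro z sˣ (∨-upperˡ z′ y′) dim-s , ∨-upperʳ z′ y′)
            (λ { {w} (z⋖w , y⊑w) → X.sym {sˣ} {w} (⊑-antisym-dim sˣ w
                   (∨-least z′ y′ (proj₁ w) (proj₁ z⋖w) y⊑w)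
                   (ℕₚ.≤-reflexive (≡.trans (⋖-dim z w z⋖w) (≡.sym dim-s)))) })
            where
            sˣ : X
            sˣ = s , λ {v} → dim≡0⇒trivial s h t≡0 {v}

          α≡0 : t ≡ 1 → α ≡ 0
          α≡0 t≡1 = #ˣ.count-empty (upper? y z) (λ { w (z⋖w , y⊑w) → contradiction
            (begin
              1                    ≡⟨ t≡1 ⟨
              dim (s ∧ h)          ≤⟨ dim-mono {s ∧ h} {proj₁ w ∧ h} (∧-greatest (s ∧ h) (proj₁ w) h
                                        (∨-least z′ y′ (proj₁ w) (proj₁ z⋖w) y⊑w ∘ ∧-lowerˡ s h)
                                        (∧-lowerʳ s h)) ⟩
              dim (proj₁ w ∧ h)    ≡⟨ dim∧h≡0 w ⟩
              0                    ∎)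
            λ () })
            where open ℕₚ.≤-Reasoning

          -- s ∧ h meets the hyperplane z of s trivially.
          t≡0⊎t≡1 : t ≡ 0 ⊎ t ≡ 1
          t≡0⊎t≡1 with s ∧ h ≤? z′
          ... | yes s∧h⊑z = inj₁ (ℕₚ.n≤0⇒n≡0 (ℕₚ.≤-trans
                  (dim-mono {s ∧ h} {z′ ∧ h} (∧-greatest (s ∧ h) z′ h s∧h⊑z (∧-lowerʳ s h)))
                  (ℕₚ.≤-reflexive (dim∧h≡0 z))))
          ... | no s∧h⋢z = inj₂ (≡.trans
                  (≡.sym (hyperplane-meet z′ (s ∧ h) s s∧h⋢z (∨-upperˡ z′ y′) (∧-lowerˡ s h) dim-s))
                  (≡.cong suc (ℕₚ.n≤0⇒n≡0 (ℕₚ.≤-trans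
                    (dim-mono {z′ ∧ s ∧ h} {z′ ∧ h} (∧-greatest (z′ ∧ s ∧ h) z′ h
                      (∧-lowerˡ z′ (s ∧ h)) (∧-lowerʳ s h ∘ ∧-lowerʳ z′ (s ∧ h))))
                    (ℕₚ.≤-reflexive (dim∧h≡0 z))))))

          -- Both `k` and `a + q` solve the cover equation of `y` within `s`. The cases that occur
          -- are `a = 1`, `t = 0` and `a = 0`, `t = 1`.
          solution : ∀ {a} → α ≡ a → (a ℕ.+ q) ℕ.* q ℕ.+ q^ t ≡ (a ℕ.+ q) ℕ.+ q^ 2 →
                     α ℕ.+ q ℕ.* ε ≡ up-down-up y z
          solution {a} α≡a eq = begin
            α ℕ.+ q ℕ.* ε      ≡⟨ ≡.cong₂ (λ a e → a ℕ.+ q ℕ.* e) α≡a ε≡1 ⟩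
            a ℕ.+ q ℕ.* 1      ≡⟨ ≡.cong (a ℕ.+_) (ℕₚ.*-identityʳ q) ⟩
            a ℕ.+ q            ≡⟨ affine-unique 1<q {x = q^ t} {z = q^ 2} eq k-equation ⟩
            k                  ≡⟨ up-down-up≡k ⟨
            up-down-up y z        ∎
            where open ≡.≡-Reasoning

        path-identity-near : α ℕ.+ q ℕ.* ε ≡ up-down-up y z
        path-identity-near with t≡0⊎t≡1
        ... | inj₁ t≡0 = solution (α≡1 t≡0)
                (≡.trans (≡.cong (λ t → (1 ℕ.+ q) ℕ.* q ℕ.+ q^ t) t≡0) (poly q))
                where
                poly : ∀ q → (1 ℕ.+ q) ℕ.* q ℕ.+ 1 ≡ 1 ℕ.+ q ℕ.+ q ℕ.* (q ℕ.* 1)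
                poly = solve-∀
        ... | inj₂ t≡1 = solution (α≡0 t≡1)
                (≡.trans (≡.cong (λ t → (0 ℕ.+ q) ℕ.* q ℕ.+ q^ t) t≡1) (poly q))
                where
                poly : ∀ q → (0 ℕ.+ q) ℕ.* q ℕ.+ q ℕ.* 1 ≡ 0 ℕ.+ q ℕ.+ q ℕ.* (q ℕ.* 1)
                poly = solve-∀

    path-identity : α ℕ.+ q ℕ.* ε ℕ.+ q^ d ℕ.* ⟦ y ⋖? z ⟧ ≡ up-down-up y z
    path-identity with y ⋖? z
    ... | yes y⋖z = ≡.trans (≡.cong (α ℕ.+ q ℕ.* ε ℕ.+_) (ℕₚ.*-identityʳ (q^ d))) (path-identity-⋖ y⋖z)
    ... | no ¬y⋖z = ≡.trans (≡.trans (≡.cong (α ℕ.+ q ℕ.* ε ℕ.+_) (ℕₚ.*-zeroʳ (q^ d))) (ℕₚ.+-identityʳ _))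
                            (not-below (suc (dim (proj₁ z ∧ proj₁ y)) ℕₚ.≟ dimˣ y))
      where
      y⋢z : ¬ proj₁ y ⊑ proj₁ z
      y⋢z y⊑z = ¬y⋖z (⋖-intro y z y⊑z dim-z)

      not-below : Dec (suc (dim (proj₁ z ∧ proj₁ y)) ≡ dimˣ y) → α ℕ.+ q ℕ.* ε ≡ up-down-up y z
      not-below (yes near) = path-identity-near y⋢z near
      not-below (no far)   = path-identity-far y⋢z far

    weighted-path-identity : up-up-down y z ℕ.+ q ℕ.* down-up-up y z ℕ.+ suc q ℕ.* (q^ d ℕ.* ⟦ y ⋖? z ⟧) ≡
                             suc q ℕ.* up-down-up y z
    weighted-path-identity = begin
      up-up-down y z ℕ.+ q ℕ.* down-up-up y z ℕ.+ suc q ℕ.* (q^ d ℕ.* ⟦ y ⋖? z ⟧)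
        ≡⟨ ≡.cong₂ (λ a e → a ℕ.+ q ℕ.* e ℕ.+ suc q ℕ.* (q^ d ℕ.* ⟦ y ⋖? z ⟧))
             (up-up-down≡upper y z dim-z) (down-up-up≡lower y z dim-z) ⟩
      suc q ℕ.* α ℕ.+ q ℕ.* (suc q ℕ.* ε) ℕ.+ suc q ℕ.* (q^ d ℕ.* ⟦ y ⋖? z ⟧)
        ≡⟨ factor q α ε (q^ d ℕ.* ⟦ y ⋖? z ⟧) ⟩
      suc q ℕ.* (α ℕ.+ q ℕ.* ε ℕ.+ q^ d ℕ.* ⟦ y ⋖? z ⟧)
        ≡⟨ ≡.cong (suc q ℕ.*_) path-identity ⟩
      suc q ℕ.* up-down-up y z ∎
      where
      open ≡.≡-Reasoning

      factor : ∀ q a e x → suc q ℕ.* a ℕ.+ q ℕ.* (suc q ℕ.* e) ℕ.+ suc q ℕ.* x ≡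
                           suc q ℕ.* (a ℕ.+ q ℕ.* e ℕ.+ x)
      factor = solve-∀

-- The matrices over ℕ

module NaturalMatrices {c ℓ ℓ# m ℓm : Level} {q n : ℕ} (F : HeytingField c ℓ ℓ#) (F-size : setoid F HasSize q)
  (H : Module (ring F) m ℓm) (H-dim : LinearAlgebra.HasDimension F H n)
  (h : LinearAlgebra.Subspace F H) where

  open AttenuatedSpace F F-size H H-dim h using (X)
  open LinearAlgebra F H using (dim)
  open FiniteLinearAlgebra F F-size H using (dim-mono; q-nonZero)
  open Dimension F F-size H H-dim using (full; ⊑-full)
  open Covering F F-size H H-dim h

  Matℕ : Set _
  Matℕ = X → X → ℕ

  infixl 8 _⊗_

  _⊗_ : Matℕ → Matℕ → Matℕ
  (A ⊗ B) y z = #ˣ.∑ (λ w → A y w ℕ.* B w z)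

  ⊗-assoc : ∀ (A B C : Matℕ) y z → (A ⊗ B ⊗ C) y z ≡ (A ⊗ (B ⊗ C)) y z
  ⊗-assoc A B C y z = begin
    #ˣ.∑ (λ w → #ˣ.∑ (λ x → A y x ℕ.* B x w) ℕ.* C w z)
      ≡⟨ #ˣ.∑-cong (λ w → ≡.sym (#ˣ.∑-*ʳ (λ x → A y x ℕ.* B x w) (C w z))) ⟩
    #ˣ.∑ (λ w → #ˣ.∑ (λ x → A y x ℕ.* B x w ℕ.* C w z))
      ≡⟨ double-counting X-size X-size (λ w x → A y x ℕ.* B x w ℕ.* C w z) ⟩
    #ˣ.∑ (λ x → #ˣ.∑ (λ w → A y x ℕ.* B x w ℕ.* C w z))
      ≡⟨ #ˣ.∑-cong (λ x → ≡.trans (#ˣ.∑-cong (λ w → ℕₚ.*-assoc (A y x) (B x w) (C w z)))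
                                  (#ˣ.∑-*ˡ (A y x) (λ w → B x w ℕ.* C w z))) ⟩
    #ˣ.∑ (λ x → A y x ℕ.* #ˣ.∑ (λ w → B x w ℕ.* C w z)) ∎
    where open ≡.≡-Reasoning

  -- The two offsets avoid subtraction: dim z - dim y is constantly a - b on the support of A.
  HasDegree : ℕ → ℕ → Matℕ → Set _
  HasDegree a b A = ∀ y z → dimˣ y ℕ.+ a ≢ dimˣ z ℕ.+ b → A y z ≡ 0

  -- A middle index respecting both offsets would make `y` and `z` respect their sum, so one factor
  -- vanishes at every `w`.
  ⊗-degree : ∀ {a b a′ b′} (A B : Matℕ) → HasDegree a b A → HasDegree a′ b′ B →
             HasDegree (a ℕ.+ a′) (b ℕ.+ b′) (A ⊗ B)
  ⊗-degree {a} {b} {a′} {b′} A B A-degree B-degree y z ungraded = #ˣ.∑-zero vanish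
    where
    open ≡.≡-Reasoning

    vanish : ∀ w → A y w ℕ.* B w z ≡ 0
    vanish w with dimˣ y ℕ.+ a ℕₚ.≟ dimˣ w ℕ.+ b
    ... | no ungraded′ = ≡.cong (ℕ._* B w z) (A-degree y w ungraded′)
    ... | yes eq = ≡.trans (≡.cong (A y w ℕ.*_) (B-degree w z (λ eq′ → ungraded (begin
      dimˣ y ℕ.+ (a ℕ.+ a′)     ≡⟨ ℕₚ.+-assoc (dimˣ y) a a′ ⟨
      dimˣ y ℕ.+ a ℕ.+ a′       ≡⟨ ≡.cong (ℕ._+ a′) eq ⟩
      dimˣ w ℕ.+ b ℕ.+ a′       ≡⟨ exchange (dimˣ w) b a′ ⟩
      dimˣ w ℕ.+ a′ ℕ.+ b       ≡⟨ ≡.cong (ℕ._+ b) eq′ ⟩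
      dimˣ z ℕ.+ b′ ℕ.+ b       ≡⟨ exchange (dimˣ z) b′ b ⟩
      dimˣ z ℕ.+ b ℕ.+ b′       ≡⟨ ℕₚ.+-assoc (dimˣ z) b b′ ⟩
      dimˣ z ℕ.+ (b ℕ.+ b′)     ∎)))) (ℕₚ.*-zeroʳ (A y w))
      where
      exchange : ∀ x y z → x ℕ.+ y ℕ.+ z ≡ x ℕ.+ z ℕ.+ y
      exchange = solve-∀

  q^ : ℕ → ℕ
  q^ = q ℕ.^_

  Rℕ Lℕ : Matℕ
  Rℕ y z = ⟦ z ⋖? y ⟧
  Lℕ y z = ⟦ y ⋖? z ⟧ ℕ.* q^ (dimˣ y)

  R-degree : HasDegree 0 1 Rℕ
  R-degree y z ungraded = ⟦⟧-false (z ⋖? y) (λ z⋖y → ungraded (≡.trans (ℕₚ.+-identityʳ (dimˣ y)) (proj₂ z⋖y)))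

  L-degree : HasDegree 1 0 Lℕ
  L-degree y z ungraded = ≡.cong (ℕ._* q^ (dimˣ y)) (⟦⟧-false (y ⋖? z)
    (λ y⋖z → ungraded (≡.trans (≡.sym (proj₂ y⋖z)) (≡.sym (ℕₚ.+-identityʳ (dimˣ z))))))

  RR≡between : ∀ (y z : X) → (Rℕ ⊗ Rℕ) y z ≡ between z y
  RR≡between y z = #ˣ.∑-cong (λ w → ≡.trans (ℕₚ.*-comm ⟦ w ⋖? y ⟧ ⟦ z ⋖? w ⟧)
    (≡.sym (⟦⟧-× (z ⋖? w) (w ⋖? y))))

  LL≡between : ∀ (y z : X) → (Lℕ ⊗ Lℕ) y z ≡ between y z ℕ.* (q^ (dimˣ y) ℕ.* q^ (suc (dimˣ y)))
  LL≡between y z = ≡.trans (#ˣ.∑-cong entry) (#ˣ.∑-*ʳ _ (q^ i ℕ.* q^ (suc i)))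
    where
    open ≡.≡-Reasoning
    i = dimˣ y

    regroup : ∀ a b x y → a ℕ.* x ℕ.* (b ℕ.* y) ≡ a ℕ.* (b ℕ.* (x ℕ.* y))
    regroup = solve-∀

    entry : ∀ w → Lℕ y w ℕ.* Lℕ w z ≡ ⟦ between? y z w ⟧ ℕ.* (q^ i ℕ.* q^ (suc i))
    entry w = begin
      Lℕ y w ℕ.* Lℕ w z
        ≡⟨ regroup ⟦ y ⋖? w ⟧ ⟦ w ⋖? z ⟧ (q^ i) (q^ (dimˣ w)) ⟩
      ⟦ y ⋖? w ⟧ ℕ.* (⟦ w ⋖? z ⟧ ℕ.* (q^ i ℕ.* q^ (dimˣ w)))
        ≡⟨ ⟦⟧-*-cong (y ⋖? w) (λ y⋖w →
             ≡.cong (λ j → ⟦ w ⋖? z ⟧ ℕ.* (q^ i ℕ.* q^ j)) (⋖-dim y w y⋖w)) ⟩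
      ⟦ y ⋖? w ⟧ ℕ.* (⟦ w ⋖? z ⟧ ℕ.* (q^ i ℕ.* q^ (suc i)))
        ≡⟨ ℕₚ.*-assoc ⟦ y ⋖? w ⟧ ⟦ w ⋖? z ⟧ _ ⟨
      ⟦ y ⋖? w ⟧ ℕ.* ⟦ w ⋖? z ⟧ ℕ.* (q^ i ℕ.* q^ (suc i))
        ≡⟨ ≡.cong (ℕ._* (q^ i ℕ.* q^ (suc i))) (⟦⟧-× (y ⋖? w) (w ⋖? z)) ⟨
      ⟦ between? y z w ⟧ ℕ.* (q^ i ℕ.* q^ (suc i)) ∎

  -- All common lower covers have dimension `j`, so they carry the same weight; naming `j` avoids a
  -- predecessor.
  RL≡meets : ∀ (y z : X) {j} → dimˣ y ≡ suc j → (Rℕ ⊗ Lℕ) y z ≡ meets y z ℕ.* q^ j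
  RL≡meets y z {j} dim-y = ≡.trans (#ˣ.∑-cong entry) (#ˣ.∑-*ʳ _ (q^ j))
    where
    open ≡.≡-Reasoning
    entry : ∀ w → Rℕ y w ℕ.* Lℕ w z ≡ ⟦ meet? y z w ⟧ ℕ.* q^ j
    entry w = begin
      ⟦ w ⋖? y ⟧ ℕ.* (⟦ w ⋖? z ⟧ ℕ.* q^ (dimˣ w))
        ≡⟨ ⟦⟧-*-cong (w ⋖? y) (λ w⋖y → ≡.cong (λ k → ⟦ w ⋖? z ⟧ ℕ.* q^ k)
             (ℕₚ.suc-injective (≡.trans (≡.sym (⋖-dim w y w⋖y)) dim-y))) ⟩
      ⟦ w ⋖? y ⟧ ℕ.* (⟦ w ⋖? z ⟧ ℕ.* q^ j)
        ≡⟨ ℕₚ.*-assoc ⟦ w ⋖? y ⟧ ⟦ w ⋖? z ⟧ (q^ j) ⟨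
      ⟦ w ⋖? y ⟧ ℕ.* ⟦ w ⋖? z ⟧ ℕ.* q^ j
        ≡⟨ ≡.cong (ℕ._* q^ j) (⟦⟧-× (w ⋖? y) (w ⋖? z)) ⟨
      ⟦ meet? y z w ⟧ ℕ.* q^ j ∎

  private
    *-swapʳ : ∀ a b c → a ℕ.* b ℕ.* c ≡ (c ℕ.* a) ℕ.* b
    *-swapʳ = solve-∀

  -- Entries of the triple products

  module _ (y z : X) (dim-z : dimˣ z ≡ suc (dimˣ y)) where
    private
      i = dimˣ y

    LLR≡ : (Lℕ ⊗ Lℕ ⊗ Rℕ) y z ≡ up-up-down y z ℕ.* (q^ i ℕ.* q^ (suc i))
    LLR≡ = ≡.trans (#ˣ.∑-cong (λ w → ≡.trans (≡.cong (ℕ._* Rℕ w z) (LL≡between y w))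
      (*-swapʳ (between y w) _ ⟦ z ⋖? w ⟧))) (#ˣ.∑-*ʳ _ (q^ i ℕ.* q^ (suc i)))

    LRL≡ : (Lℕ ⊗ Rℕ ⊗ Lℕ) y z ≡ up-down-up y z ℕ.* (q^ i ℕ.* q^ i)
    LRL≡ = ≡.trans (⊗-assoc Lℕ Rℕ Lℕ y z) (≡.trans (#ˣ.∑-cong (λ w → begin
      ⟦ y ⋖? w ⟧ ℕ.* q^ i ℕ.* (Rℕ ⊗ Lℕ) w z
        ≡⟨ ℕₚ.*-assoc ⟦ y ⋖? w ⟧ (q^ i) _ ⟩
      ⟦ y ⋖? w ⟧ ℕ.* (q^ i ℕ.* (Rℕ ⊗ Lℕ) w z)
        ≡⟨ ⟦⟧-*-cong (y ⋖? w) (λ y⋖w → ≡.cong (q^ i ℕ.*_)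
             (≡.trans (RL≡meets w z (⋖-dim y w y⋖w)) (≡.cong (ℕ._* q^ i) (meets-comm w z)))) ⟩
      ⟦ y ⋖? w ⟧ ℕ.* (q^ i ℕ.* (meets z w ℕ.* q^ i))
        ≡⟨ regroup ⟦ y ⋖? w ⟧ (q^ i) (meets z w) ⟩
      ⟦ y ⋖? w ⟧ ℕ.* meets z w ℕ.* (q^ i ℕ.* q^ i) ∎)) (#ˣ.∑-*ʳ _ (q^ i ℕ.* q^ i)))
      where
      open ≡.≡-Reasoning
      regroup : ∀ a x b → a ℕ.* (x ℕ.* (b ℕ.* x)) ≡ a ℕ.* b ℕ.* (x ℕ.* x)
      regroup = solve-∀

    -- The extra `q` turns the weight `q ^ (i - 1)` of an element below `y` into `q ^ i`, so no
    -- negative exponent appears.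
    q*RLL≡ : q ℕ.* (Rℕ ⊗ Lℕ ⊗ Lℕ) y z ≡ down-up-up y z ℕ.* (q^ i ℕ.* q^ i)
    q*RLL≡ = ≡.trans (≡.cong (q ℕ.*_) (⊗-assoc Rℕ Lℕ Lℕ y z))
      (≡.trans (≡.sym (#ˣ.∑-*ˡ q _)) (≡.trans (#ˣ.∑-cong (λ w → begin
      q ℕ.* (⟦ w ⋖? y ⟧ ℕ.* (Lℕ ⊗ Lℕ) w z)
        ≡⟨ ≡.cong (λ k → q ℕ.* (⟦ w ⋖? y ⟧ ℕ.* k)) (LL≡between w z) ⟩
      q ℕ.* (⟦ w ⋖? y ⟧ ℕ.* (between w z ℕ.* (q^ (dimˣ w) ℕ.* q^ (suc (dimˣ w)))))
        ≡⟨ regroup q ⟦ w ⋖? y ⟧ (between w z) (q^ (dimˣ w)) ⟩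
      ⟦ w ⋖? y ⟧ ℕ.* (between w z ℕ.* (q^ (suc (dimˣ w)) ℕ.* q^ (suc (dimˣ w))))
        ≡⟨ ⟦⟧-*-cong (w ⋖? y) (λ w⋖y → ≡.cong (λ j → between w z ℕ.* (q^ j ℕ.* q^ j))
             (≡.sym (⋖-dim w y w⋖y))) ⟩
      ⟦ w ⋖? y ⟧ ℕ.* (between w z ℕ.* (q^ i ℕ.* q^ i))
        ≡⟨ ℕₚ.*-assoc ⟦ w ⋖? y ⟧ (between w z) _ ⟨
      ⟦ w ⋖? y ⟧ ℕ.* between w z ℕ.* (q^ i ℕ.* q^ i) ∎)) (#ˣ.∑-*ʳ _ (q^ i ℕ.* q^ i))))
      where
      open ≡.≡-Reasoning
      regroup : ∀ q a b x → q ℕ.* (a ℕ.* (b ℕ.* (x ℕ.* (q ℕ.* x)))) ≡ a ℕ.* (b ℕ.* (q ℕ.* x ℕ.* (q ℕ.* x)))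
      regroup = solve-∀

    -- The transposed entry at `(z , y)` counts the paths from `y` to `z` read backwards. Here and
    -- in the next two lemmas the path counts are those above, with weights smaller by a factor
    -- `q ^ i`.
    LRR≡ : (Lℕ ⊗ Rℕ ⊗ Rℕ) z y ≡ up-up-down y z ℕ.* q^ (suc i)
    LRR≡ = ≡.trans (⊗-assoc Lℕ Rℕ Rℕ z y) (≡.trans (#ˣ.∑-cong (λ w → begin
      ⟦ z ⋖? w ⟧ ℕ.* q^ (dimˣ z) ℕ.* (Rℕ ⊗ Rℕ) w y
        ≡⟨ ≡.cong₂ (λ j k → ⟦ z ⋖? w ⟧ ℕ.* q^ j ℕ.* k) dim-z (RR≡between w y) ⟩
      ⟦ z ⋖? w ⟧ ℕ.* q^ (suc i) ℕ.* between y w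
        ≡⟨ regroup ⟦ z ⋖? w ⟧ (q^ (suc i)) (between y w) ⟩
      ⟦ z ⋖? w ⟧ ℕ.* between y w ℕ.* q^ (suc i) ∎)) (#ˣ.∑-*ʳ _ (q^ (suc i))))
      where
      open ≡.≡-Reasoning
      regroup : ∀ a x b → a ℕ.* x ℕ.* b ≡ a ℕ.* b ℕ.* x
      regroup = solve-∀

    RLR≡ : (Rℕ ⊗ Lℕ ⊗ Rℕ) z y ≡ up-down-up y z ℕ.* q^ i
    RLR≡ = ≡.trans (#ˣ.∑-cong (λ w → ≡.trans
      (≡.cong (ℕ._* ⟦ y ⋖? w ⟧) (RL≡meets z w dim-z))
      (*-swapʳ (meets z w) (q^ i) ⟦ y ⋖? w ⟧))) (#ˣ.∑-*ʳ _ (q^ i))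

    q*RRL≡ : q ℕ.* (Rℕ ⊗ Rℕ ⊗ Lℕ) z y ≡ down-up-up y z ℕ.* q^ i
    q*RRL≡ = ≡.trans (≡.sym (#ˣ.∑-*ˡ q _)) (≡.trans (#ˣ.∑-cong (λ w → begin
      q ℕ.* ((Rℕ ⊗ Rℕ) z w ℕ.* (⟦ w ⋖? y ⟧ ℕ.* q^ (dimˣ w)))
        ≡⟨ ≡.cong (λ k → q ℕ.* (k ℕ.* (⟦ w ⋖? y ⟧ ℕ.* q^ (dimˣ w)))) (RR≡between z w) ⟩
      q ℕ.* (between w z ℕ.* (⟦ w ⋖? y ⟧ ℕ.* q^ (dimˣ w)))
        ≡⟨ regroup q ⟦ w ⋖? y ⟧ (between w z) (q^ (dimˣ w)) ⟩
      ⟦ w ⋖? y ⟧ ℕ.* (between w z ℕ.* q^ (suc (dimˣ w)))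
        ≡⟨ ⟦⟧-*-cong (w ⋖? y) (λ w⋖y → ≡.cong (λ j → between w z ℕ.* q^ j) (≡.sym (⋖-dim w y w⋖y))) ⟩
      ⟦ w ⋖? y ⟧ ℕ.* (between w z ℕ.* q^ i)
        ≡⟨ ℕₚ.*-assoc ⟦ w ⋖? y ⟧ (between w z) _ ⟨
      ⟦ w ⋖? y ⟧ ℕ.* between w z ℕ.* q^ i ∎)) (#ˣ.∑-*ʳ _ (q^ i)))
      where
      open ≡.≡-Reasoning
      regroup : ∀ q a b x → q ℕ.* (b ℕ.* (a ℕ.* x)) ≡ a ℕ.* (b ℕ.* (q ℕ.* x))
      regroup = solve-∀

    private
      d = n ℕ.∸ dimˣ z

      dim-H : n ≡ dimˣ z ℕ.+ d
      -- The truncated subtraction is exact, since `z` lies in `full`, of dimension `n`.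
      dim-H = ≡.sym (ℕₚ.m+[n∸m]≡n (dim-mono {proj₁ z} {full} (⊑-full (proj₁ z))))

      q^n : q^ n ≡ q ℕ.* q^ i ℕ.* q^ d
      q^n = begin
        q^ n                     ≡⟨ ≡.cong q^ dim-H ⟩
        q^ (dimˣ z ℕ.+ d)        ≡⟨ ≡.cong (λ j → q^ (j ℕ.+ d)) dim-z ⟩
        q^ (suc i ℕ.+ d)         ≡⟨ ℕₚ.^-distribˡ-+-* q (suc i) d ⟩
        q ℕ.* q^ i ℕ.* q^ d      ∎
        where open ≡.≡-Reasoning

    -- The negative term of the relation stands alone on the right, which keeps everything in ℕ.
    -- Pulling out `q * q ^ i * q ^ i` leaves `weighted-path-identity`.
    LLR-relation-graded : (Lℕ ⊗ Lℕ ⊗ Rℕ) y z ℕ.+ q^ 3 ℕ.* (Rℕ ⊗ Lℕ ⊗ Lℕ) y z ℕ.+ q^ n ℕ.* (q ℕ.+ 1) ℕ.* Lℕ y z ≡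
                          q ℕ.* (q ℕ.+ 1) ℕ.* (Lℕ ⊗ Rℕ ⊗ Lℕ) y z
    LLR-relation-graded = begin
      (Lℕ ⊗ Lℕ ⊗ Rℕ) y z ℕ.+ q^ 3 ℕ.* (Rℕ ⊗ Lℕ ⊗ Lℕ) y z ℕ.+ q^ n ℕ.* (q ℕ.+ 1) ℕ.* Lℕ y z
        ≡⟨ ≡.cong (λ k → (Lℕ ⊗ Lℕ ⊗ Rℕ) y z ℕ.+ k ℕ.+ q^ n ℕ.* (q ℕ.+ 1) ℕ.* Lℕ y z)
             (q³ q ((Rℕ ⊗ Lℕ ⊗ Lℕ) y z)) ⟩
      (Lℕ ⊗ Lℕ ⊗ Rℕ) y z ℕ.+ q ℕ.* q ℕ.* (q ℕ.* (Rℕ ⊗ Lℕ ⊗ Lℕ) y z) ℕ.+ q^ n ℕ.* (q ℕ.+ 1) ℕ.* Lℕ y z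
        ≡⟨ ≡.cong₂ ℕ._+_ (≡.cong₂ (λ j k → j ℕ.+ q ℕ.* q ℕ.* k) LLR≡ q*RLL≡)
             (≡.cong (λ k → k ℕ.* (q ℕ.+ 1) ℕ.* Lℕ y z) q^n) ⟩
      up-up-down y z ℕ.* (q^ i ℕ.* q^ (suc i)) ℕ.+ q ℕ.* q ℕ.* (down-up-up y z ℕ.* (q^ i ℕ.* q^ i))
        ℕ.+ q ℕ.* q^ i ℕ.* q^ d ℕ.* (q ℕ.+ 1) ℕ.* (⟦ y ⋖? z ⟧ ℕ.* q^ i)
        ≡⟨ regroup₁ q (q^ i) (q^ d) (up-up-down y z) (down-up-up y z) ⟦ y ⋖? z ⟧ ⟩
      q ℕ.* (q^ i ℕ.* q^ i) ℕ.* (up-up-down y z ℕ.+ q ℕ.* down-up-up y z ℕ.+ suc q ℕ.* (q^ d ℕ.* ⟦ y ⋖? z ⟧))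
        ≡⟨ ≡.cong (q ℕ.* (q^ i ℕ.* q^ i) ℕ.*_) (weighted-path-identity y z dim-z d dim-H) ⟩
      q ℕ.* (q^ i ℕ.* q^ i) ℕ.* (suc q ℕ.* up-down-up y z)
        ≡⟨ regroup₂ q (q^ i ℕ.* q^ i) (up-down-up y z) ⟩
      q ℕ.* (q ℕ.+ 1) ℕ.* (up-down-up y z ℕ.* (q^ i ℕ.* q^ i))
        ≡⟨ ≡.cong (q ℕ.* (q ℕ.+ 1) ℕ.*_) LRL≡ ⟨
      q ℕ.* (q ℕ.+ 1) ℕ.* (Lℕ ⊗ Rℕ ⊗ Lℕ) y z ∎
      where
      open ≡.≡-Reasoning

      q³ : ∀ q x → q ℕ.* (q ℕ.* (q ℕ.* 1)) ℕ.* x ≡ q ℕ.* q ℕ.* (q ℕ.* x)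
      q³ = solve-∀

      regroup₁ : ∀ q x w a e b →
        a ℕ.* (x ℕ.* (q ℕ.* x)) ℕ.+ q ℕ.* q ℕ.* (e ℕ.* (x ℕ.* x)) ℕ.+ q ℕ.* x ℕ.* w ℕ.* (q ℕ.+ 1) ℕ.* (b ℕ.* x) ≡
        q ℕ.* (x ℕ.* x) ℕ.* (a ℕ.+ q ℕ.* e ℕ.+ suc q ℕ.* (w ℕ.* b))
      regroup₁ = solve-∀

      regroup₂ : ∀ q x b → q ℕ.* x ℕ.* (suc q ℕ.* b) ≡ q ℕ.* (q ℕ.+ 1) ℕ.* (b ℕ.* x)
      regroup₂ = solve-∀

    LRR-relation-graded : (Lℕ ⊗ Rℕ ⊗ Rℕ) z y ℕ.+ q^ 3 ℕ.* (Rℕ ⊗ Rℕ ⊗ Lℕ) z y ℕ.+ q^ n ℕ.* (q ℕ.+ 1) ℕ.* Rℕ z y ≡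
                          q ℕ.* (q ℕ.+ 1) ℕ.* (Rℕ ⊗ Lℕ ⊗ Rℕ) z y
    LRR-relation-graded = begin
      (Lℕ ⊗ Rℕ ⊗ Rℕ) z y ℕ.+ q^ 3 ℕ.* (Rℕ ⊗ Rℕ ⊗ Lℕ) z y ℕ.+ q^ n ℕ.* (q ℕ.+ 1) ℕ.* Rℕ z y
        ≡⟨ ≡.cong (λ k → (Lℕ ⊗ Rℕ ⊗ Rℕ) z y ℕ.+ k ℕ.+ q^ n ℕ.* (q ℕ.+ 1) ℕ.* Rℕ z y)
             (q³ q ((Rℕ ⊗ Rℕ ⊗ Lℕ) z y)) ⟩
      (Lℕ ⊗ Rℕ ⊗ Rℕ) z y ℕ.+ q ℕ.* q ℕ.* (q ℕ.* (Rℕ ⊗ Rℕ ⊗ Lℕ) z y) ℕ.+ q^ n ℕ.* (q ℕ.+ 1) ℕ.* Rℕ z y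
        ≡⟨ ≡.cong₂ ℕ._+_ (≡.cong₂ (λ j k → j ℕ.+ q ℕ.* q ℕ.* k) LRR≡ q*RRL≡)
             (≡.cong (λ k → k ℕ.* (q ℕ.+ 1) ℕ.* Rℕ z y) q^n) ⟩
      up-up-down y z ℕ.* q^ (suc i) ℕ.+ q ℕ.* q ℕ.* (down-up-up y z ℕ.* q^ i)
        ℕ.+ q ℕ.* q^ i ℕ.* q^ d ℕ.* (q ℕ.+ 1) ℕ.* ⟦ y ⋖? z ⟧
        ≡⟨ regroup₁ q (q^ i) (q^ d) (up-up-down y z) (down-up-up y z) ⟦ y ⋖? z ⟧ ⟩
      q ℕ.* q^ i ℕ.* (up-up-down y z ℕ.+ q ℕ.* down-up-up y z ℕ.+ suc q ℕ.* (q^ d ℕ.* ⟦ y ⋖? z ⟧))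
        ≡⟨ ≡.cong (q ℕ.* q^ i ℕ.*_) (weighted-path-identity y z dim-z d dim-H) ⟩
      q ℕ.* q^ i ℕ.* (suc q ℕ.* up-down-up y z)
        ≡⟨ regroup₂ q (q^ i) (up-down-up y z) ⟩
      q ℕ.* (q ℕ.+ 1) ℕ.* (up-down-up y z ℕ.* q^ i)
        ≡⟨ ≡.cong (q ℕ.* (q ℕ.+ 1) ℕ.*_) RLR≡ ⟨
      q ℕ.* (q ℕ.+ 1) ℕ.* (Rℕ ⊗ Lℕ ⊗ Rℕ) z y ∎
      where
      open ≡.≡-Reasoning

      q³ : ∀ q x → q ℕ.* (q ℕ.* (q ℕ.* 1)) ℕ.* x ≡ q ℕ.* q ℕ.* (q ℕ.* x)
      q³ = solve-∀

      regroup₁ : ∀ q x w a e b →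
        a ℕ.* (q ℕ.* x) ℕ.+ q ℕ.* q ℕ.* (e ℕ.* x) ℕ.+ q ℕ.* x ℕ.* w ℕ.* (q ℕ.+ 1) ℕ.* b ≡
        q ℕ.* x ℕ.* (a ℕ.+ q ℕ.* e ℕ.+ suc q ℕ.* (w ℕ.* b))
      regroup₁ = solve-∀

      regroup₂ : ∀ q x b → q ℕ.* x ℕ.* (suc q ℕ.* b) ≡ q ℕ.* (q ℕ.+ 1) ℕ.* (b ℕ.* x)
      regroup₂ = solve-∀

  private
    vanishing : ∀ a b c {j k l m} → j ≡ 0 → k ≡ 0 → l ≡ 0 → m ≡ 0 →
                j ℕ.+ a ℕ.* k ℕ.+ b ℕ.* l ≡ c ℕ.* m
    vanishing a b c ≡.refl ≡.refl ≡.refl ≡.refl = ≡.trans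
      (≡.cong₂ ℕ._+_ (ℕₚ.*-zeroʳ a) (ℕₚ.*-zeroʳ b)) (≡.sym (ℕₚ.*-zeroʳ c))

  -- Unless `dim z = dim y + 1`, all four terms vanish for reasons of degree.
  LLR-relation : ∀ (y z : X) → (Lℕ ⊗ Lℕ ⊗ Rℕ) y z ℕ.+ q^ 3 ℕ.* (Rℕ ⊗ Lℕ ⊗ Lℕ) y z ℕ.+ q^ n ℕ.* (q ℕ.+ 1) ℕ.* Lℕ y z ≡
                               q ℕ.* (q ℕ.+ 1) ℕ.* (Lℕ ⊗ Rℕ ⊗ Lℕ) y z
  LLR-relation y z with dimˣ z ℕₚ.≟ suc (dimˣ y)
  ... | yes dim-z = LLR-relation-graded y z dim-z
  ... | no ungraded = vanishing (q^ 3) (q^ n ℕ.* (q ℕ.+ 1)) (q ℕ.* (q ℕ.+ 1))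
    (⊗-degree (Lℕ ⊗ Lℕ) Rℕ (⊗-degree Lℕ Lℕ L-degree L-degree) R-degree y z off₂)
    (⊗-degree (Rℕ ⊗ Lℕ) Lℕ (⊗-degree Rℕ Lℕ R-degree L-degree) L-degree y z off₂)
    (L-degree y z off₁)
    (⊗-degree (Lℕ ⊗ Rℕ) Lℕ (⊗-degree Lℕ Rℕ L-degree R-degree) L-degree y z off₂)
    where
    off₁ : dimˣ y ℕ.+ 1 ≢ dimˣ z ℕ.+ 0
    off₁ eq = ungraded (≡.trans (≡.sym (ℕₚ.+-identityʳ (dimˣ z))) (≡.trans (≡.sym eq) (ℕₚ.+-comm (dimˣ y) 1)))

    off₂ : dimˣ y ℕ.+ 2 ≢ dimˣ z ℕ.+ 1
    off₂ eq = ungraded (ℕₚ.+-cancelʳ-≡ 1 _ _ (≡.trans (≡.sym eq) (ℕₚ.+-suc (dimˣ y) 1)))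

  LRR-relation : ∀ (y z : X) → (Lℕ ⊗ Rℕ ⊗ Rℕ) y z ℕ.+ q^ 3 ℕ.* (Rℕ ⊗ Rℕ ⊗ Lℕ) y z ℕ.+ q^ n ℕ.* (q ℕ.+ 1) ℕ.* Rℕ y z ≡
                               q ℕ.* (q ℕ.+ 1) ℕ.* (Rℕ ⊗ Lℕ ⊗ Rℕ) y z
  LRR-relation y z with dimˣ y ℕₚ.≟ suc (dimˣ z)
  ... | yes dim-y = LRR-relation-graded z y dim-y
  ... | no ungraded = vanishing (q^ 3) (q^ n ℕ.* (q ℕ.+ 1)) (q ℕ.* (q ℕ.+ 1))
    (⊗-degree (Lℕ ⊗ Rℕ) Rℕ (⊗-degree Lℕ Rℕ L-degree R-degree) R-degree y z off₂)
    (⊗-degree (Rℕ ⊗ Rℕ) Lℕ (⊗-degree Rℕ Rℕ R-degree R-degree) L-degree y z off₂)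
    (R-degree y z off₁)
    (⊗-degree (Rℕ ⊗ Lℕ) Rℕ (⊗-degree Rℕ Lℕ R-degree L-degree) R-degree y z off₂)
    where
    off₁ : dimˣ y ℕ.+ 0 ≢ dimˣ z ℕ.+ 1
    off₁ eq = ungraded (≡.trans (≡.sym (ℕₚ.+-identityʳ (dimˣ y))) (≡.trans eq (ℕₚ.+-comm (dimˣ z) 1)))

    off₂ : dimˣ y ℕ.+ 1 ≢ dimˣ z ℕ.+ 2
    off₂ eq = ungraded (ℕₚ.+-cancelʳ-≡ 1 _ _ (≡.trans eq (ℕₚ.+-suc (dimˣ z) 1)))

-- Transfer to the field

module FieldMatrices {c ℓ ℓ# m ℓm c′ ℓ′ ℓ#′ : Level} {q n : ℕ}
  (F : HeytingField c ℓ ℓ#) (F-size : setoid F HasSize q)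
  (H : Module (ring F) m ℓm) (H-dim : LinearAlgebra.HasDimension F H n)
  (h : LinearAlgebra.Subspace F H)
  (K : HeytingField c′ ℓ′ ℓ#′) (char0 : CharacteristicZero K) where

  open AttenuatedSpace F F-size H H-dim h
  open Covering F F-size H H-dim h
  open NaturalMatrices F F-size H H-dim h
  open Matrices K char0
  private
    module K = CommutativeRing (ring K)
    module Kˣ = Summation K.+-commutativeMonoid X-size
    open K using (Carrier; _≈_; 0#; _-_)
    open Mult K.semiring using (×-homo-+; ×1-homo-*; ×-congˡ) renaming (_×_ to _×′_)
    open Exp K.semiring using (^-congʳ)
    open Sum K.+-commutativeMonoid using (sum; sum-cong-≋)
    open GroupProperties K.+-group using (x≈z//y; ⁻¹-anti-homo-//)
    open RingProperties K.ring using (-‿distribˡ-*)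
    open SetoidReasoning K.setoid

  ι : ℕ → Carrier
  ι k = k ×′ 1#

  ι-+ : ∀ j k → ι (j ℕ.+ k) ≈ ι j + ι k
  ι-+ = ×-homo-+ 1#

  ι-* : ∀ j k → ι (j ℕ.* k) ≈ ι j * ι k
  ι-* = ×1-homo-*

  ι-1 : ι 1 ≈ 1#
  ι-1 = K.+-identityʳ 1#

  ι-^ : ∀ k → ι (q^ k) ≈ qᴷ ^ k
  ι-^ zero    = ι-1
  ι-^ (suc k) = K.trans (ι-* q (q^ k)) (K.*-congˡ (ι-^ k))

  ι-cong : ∀ {j k} → j ≡ k → ι j ≈ ι k
  ι-cong = ×-congˡ

  ι-∑ : ∀ f → ι (#ˣ.∑ f) ≈ sum (λ i → ι (f (X-element i)))
  ι-∑ f = K.trans (ι-cong (#ˣ.∑-sum f)) (go ∣X∣ (f ∘ X-element))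
    where
    go : ∀ k (g : Fin k → ℕ) → ι (Sum.sum ℕₚ.+-0-commutativeMonoid g) ≈ sum (ι ∘ g)
    go zero    g = K.refl
    go (suc k) g = K.trans (ι-+ (g Fin.zero) _) (K.+-congˡ (go k (g ∘ Fin.suc)))

  infix 4 _Represents_

  -- A record, so that both matrices can be recovered from the type.
  record _Represents_ (Aℕ : Matℕ) (A : Mat) : Set (c ⊔ ℓ ⊔ m ⊔ ℓm ⊔ ℓ′ ⊔ lsuc (c ⊔ ℓm)) where
    constructor represents
    field entry : ∀ y z → A y z ≈ ι (Aℕ y z)

  open _Represents_

  ·-represents : ∀ {Aℕ Bℕ A B} → Aℕ Represents A → Bℕ Represents B → (Aℕ ⊗ Bℕ) Represents (A · B)
  ·-represents {Aℕ} {Bℕ} A≈ B≈ = represents λ y z → K.trans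
    (sum-cong-≋ (λ i → K.trans
      (K.*-cong (entry A≈ y (X-element i)) (entry B≈ (X-element i) z))
      (K.sym (ι-* (Aℕ y (X-element i)) (Bℕ (X-element i) z)))))
    (K.sym (ι-∑ _))

  private
    -- Reconciles two deciders: the entries of `R` and `L` test `covers?`, those of `Rℕ` and `Lℕ`
    -- its opaque copy `⋖?`.
    if-represents : ∀ {a b} {A : Set a} {B : Set b} (d : Dec A) (e : Dec B) → (A → B) → (B → A) →
                    ∀ {x k} → ι k ≈ x → (if does d then x else 0#) ≈ ι (⟦ e ⟧ ℕ.* k)
    if-represents (yes _) (yes _) _ _ {k = k} ιk≈x =
      K.trans (K.sym ιk≈x) (ι-cong (≡.sym (ℕₚ.+-identityʳ k)))
    if-represents (yes x) (no ¬y) f _ _ = contradiction (f x) ¬y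
    if-represents (no ¬x) (yes y) _ g _ = contradiction (g y) ¬x
    if-represents (no _)  (no _)  _ _ _ = K.refl

    if-true : ∀ {a} {A : Set a} (d : Dec A) {x} → A → (if does d then x else 0#) ≈ x
    if-true (yes _) _ = K.refl
    if-true (no ¬a) a = contradiction a ¬a

    if-false : ∀ {a} {A : Set a} (d : Dec A) {x} → ¬ A → (if does d then x else 0#) ≈ 0#
    if-false (yes a) ¬a = contradiction a ¬a
    if-false (no _)  _  = K.refl

  R-represents : Rℕ Represents R
  R-represents = represents λ y z → K.trans (if-represents (y covers? z) (z ⋖? y) id id ι-1)
    (ι-cong (ℕₚ.*-identityʳ ⟦ z ⋖? y ⟧))

  L-represents : Lℕ Represents L
  L-represents = represents λ y z → if-represents (z covers? y) (y ⋖? z) id id (ι-^ (dimˣ y))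

  private
    q+1 : qᴷ + 1# ≈ ι (q ℕ.+ 1)
    q+1 = K.sym (K.trans (ι-+ q 1) (K.+-congˡ ι-1))

    q[q+1] : qᴷ * (qᴷ + 1#) ≈ ι (q ℕ.* (q ℕ.+ 1))
    q[q+1] = K.sym (K.trans (ι-* q (q ℕ.+ 1)) (K.*-congˡ (K.sym q+1)))

    qⁿ[q+1] : qᴷ ^ n * (qᴷ + 1#) ≈ ι (q^ n ℕ.* (q ℕ.+ 1))
    qⁿ[q+1] = K.sym (K.trans (ι-* (q^ n) (q ℕ.+ 1)) (K.*-cong (ι-^ n) (K.sym q+1)))

  -- `ι` preserves sums and products, so the identity in ℕ carries over to the field, where its
  -- terms can be moved across and given their signs.
  relation : ∀ {A′ B′ C′ D′ A B C D} →
             A′ Represents A → B′ Represents B → C′ Represents C → D′ Represents D →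
             (∀ y z → A′ y z ℕ.+ q^ 3 ℕ.* C′ y z ℕ.+ q^ n ℕ.* (q ℕ.+ 1) ℕ.* D′ y z ≡
                      q ℕ.* (q ℕ.+ 1) ℕ.* B′ y z) →
             A ⊖ (qᴷ * (qᴷ + 1#)) ∙ B ⊕ (qᴷ ^ 3) ∙ C ≋ (- (qᴷ ^ n * (qᴷ + 1#))) ∙ D
  relation {A′} {B′} {C′} {D′} {A} {B} {C} {D} A≈ B≈ C≈ D≈ eq y z = begin
    A y z - k * B y z + w * C y z      ≈⟨ K.+-assoc _ _ _ ⟩
    A y z + (- (k * B y z) + w * C y z)  ≈⟨ K.+-congˡ (K.+-comm _ _) ⟩
    A y z + (w * C y z - k * B y z)    ≈⟨ K.+-assoc _ _ _ ⟨
    (A y z + w * C y z) - k * B y z    ≈⟨ ⁻¹-anti-homo-// (k * B y z) (A y z + w * C y z) ⟨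
    - (k * B y z - (A y z + w * C y z))  ≈⟨ K.-‿cong (x≈z//y (l * D y z) (A y z + w * C y z) (k * B y z) total) ⟨
    - (l * D y z)                      ≈⟨ -‿distribˡ-* l (D y z) ⟩
    - l * D y z                        ∎
    where
    k = qᴷ * (qᴷ + 1#)
    l = qᴷ ^ n * (qᴷ + 1#)
    w = qᴷ ^ 3
    kℕ = q ℕ.* (q ℕ.+ 1)
    lℕ = q^ n ℕ.* (q ℕ.+ 1)

    total : l * D y z + (A y z + w * C y z) ≈ k * B y z
    total = begin
      l * D y z + (A y z + w * C y z)
        ≈⟨ K.+-comm _ _ ⟩
      A y z + w * C y z + l * D y z
        ≈⟨ K.+-cong (K.+-cong (entry A≈ y z) (K.*-cong (K.sym (ι-^ 3)) (entry C≈ y z)))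
                    (K.*-cong qⁿ[q+1] (entry D≈ y z)) ⟩
      ι (A′ y z) + ι (q^ 3) * ι (C′ y z) + ι lℕ * ι (D′ y z)
        ≈⟨ K.+-cong (K.+-congˡ (ι-* (q^ 3) (C′ y z))) (ι-* lℕ (D′ y z)) ⟨
      ι (A′ y z) + ι (q^ 3 ℕ.* C′ y z) + ι (lℕ ℕ.* D′ y z)
        ≈⟨ K.+-congʳ (ι-+ (A′ y z) (q^ 3 ℕ.* C′ y z)) ⟨
      ι (A′ y z ℕ.+ q^ 3 ℕ.* C′ y z) + ι (lℕ ℕ.* D′ y z)
        ≈⟨ ι-+ (A′ y z ℕ.+ q^ 3 ℕ.* C′ y z) (lℕ ℕ.* D′ y z) ⟨
      ι (A′ y z ℕ.+ q^ 3 ℕ.* C′ y z ℕ.+ lℕ ℕ.* D′ y z)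
        ≈⟨ ι-cong (eq y z) ⟩
      ι (kℕ ℕ.* B′ y z)
        ≈⟨ ι-* kℕ (B′ y z) ⟩
      ι kℕ * ι (B′ y z)
        ≈⟨ K.*-cong q[q+1] (entry B≈ y z) ⟨
      k * B y z ∎

  L²R : L · L · R ⊖ (qᴷ * (qᴷ + 1#)) ∙ (L · R · L) ⊕ (qᴷ ^ 3) ∙ (R · L · L)
          ≋ (- (qᴷ ^ n * (qᴷ + 1#))) ∙ L
  L²R = relation
    (·-represents (·-represents L-represents L-represents) R-represents)
    (·-represents (·-represents L-represents R-represents) L-represents)
    (·-represents (·-represents R-represents L-represents) L-represents)
    L-represents LLR-relation

  LR² : L · R · R ⊖ (qᴷ * (qᴷ + 1#)) ∙ (R · L · R) ⊕ (qᴷ ^ 3) ∙ (R · R · L)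
          ≋ (- (qᴷ ^ n * (qᴷ + 1#))) ∙ R
  LR² = relation
    (·-represents (·-represents L-represents R-represents) R-represents)
    (·-represents (·-represents R-represents L-represents) R-represents)
    (·-represents (·-represents R-represents R-represents) L-represents)
    R-represents LRR-relation

  -- The relations with `A*`

  A*-diagonal : ∀ {y z} → y X.≈ z → A* y z ≈ q⁻¹ ^ dimˣ y
  A*-diagonal {y} {z} y≈z = if-true (y X.≟ z) y≈z

  A*-off-diagonal : ∀ {y z} → ¬ y X.≈ z → A* y z ≈ 0#
  A*-off-diagonal {y} {z} y≉z = if-false (y X.≟ z) y≉z

  module _ {Aℕ : Matℕ} {A : Mat} (A≈ : Aℕ Represents A) where

    -- Only the class of `z` contributes to the product. Its listed representative may differ from
    -- `z`, which is why `Aℕ` has to respect equality of subspaces.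
    ·A* : (∀ y {w z} → w X.≈ z → Aℕ y w ≡ Aℕ y z) → ∀ y z → (A · A*) y z ≈ A y z * q⁻¹ ^ dimˣ z
    ·A* resp y z = K.trans (K.sym (Kˣ.∑-sum (λ w → A y w * A* w z))) (Kˣ.∑-single z
      (λ w w≈z → K.*-cong
        (K.trans (entry A≈ y w) (K.trans (ι-cong (resp y {w} {z} w≈z)) (K.sym (entry A≈ y z))))
        (K.trans (A*-diagonal {w} {z} w≈z) (^-congʳ q⁻¹ (dimˣ-cong w z w≈z))))
      (λ w w≉z → K.trans (K.*-congˡ (A*-off-diagonal {w} {z} w≉z)) (K.zeroʳ _)))

    A*· : (∀ {w y} z → w X.≈ y → Aℕ w z ≡ Aℕ y z) → ∀ y z → (A* · A) y z ≈ q⁻¹ ^ dimˣ y * A y z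
    A*· resp y z = K.trans (K.sym (Kˣ.∑-sum (λ w → A* y w * A w z))) (Kˣ.∑-single y
      (λ w w≈y → K.*-cong
        (A*-diagonal {y} {w} (X.sym {w} {y} w≈y))
        (K.trans (entry A≈ w z) (K.trans (ι-cong (resp {w} {y} z w≈y)) (K.sym (entry A≈ y z)))))
      (λ w w≉y → K.trans (K.*-congʳ (A*-off-diagonal {y} {w} (w≉y ∘ X.sym {y} {w}))) (K.zeroˡ _)))

  ⋖?-congʳ : ∀ x {y z} → y X.≈ z → ⟦ x ⋖? y ⟧ ≡ ⟦ x ⋖? z ⟧
  ⋖?-congʳ x {y} {z} y≈z = ⟦⟧-⇔ (x ⋖? y) (x ⋖? z) (⋖-respʳ x y z y≈z)
    (⋖-respʳ x z y (X.sym {y} {z} y≈z))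

  ⋖?-congˡ : ∀ {x y} z → x X.≈ y → ⟦ x ⋖? z ⟧ ≡ ⟦ y ⋖? z ⟧
  ⋖?-congˡ {x} {y} z x≈y = ⟦⟧-⇔ (x ⋖? z) (y ⋖? z) (⋖-respˡ x y z x≈y)
    (⋖-respˡ y x z (X.sym {x} {y} x≈y))

  RA* : R · A* ≋ qᴷ ∙ (A* · R)
  RA* y z = begin
    (R · A*) y z                         ≈⟨ ·A* R-represents (λ y {w} {z} → ⋖?-congˡ {w} {z} y) y z ⟩
    R y z * q⁻¹ ^ dimˣ z                 ≈⟨ weights (y covers? z) ⟩
    qᴷ * (q⁻¹ ^ dimˣ y * R y z)          ≈⟨ K.*-congˡ (A*· R-represents (λ {w} {y} z → ⋖?-congʳ z {w} {y}) y z) ⟨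
    qᴷ * (A* · R) y z                    ∎
    where
    -- Where `R` is nonzero, `y` is one dimension above `z`, so the two diagonal weights differ by
    -- one factor `q⁻¹`, which `qᴷ` cancels.
    weights : Dec (z ⋖ y) → R y z * q⁻¹ ^ dimˣ z ≈ qᴷ * (q⁻¹ ^ dimˣ y * R y z)
    weights (no ¬z⋖y) = K.trans (K.*-congʳ R≈0) (K.trans (K.zeroˡ _)
      (K.sym (K.trans (K.*-congˡ (K.trans (K.*-congˡ R≈0) (K.zeroʳ _))) (K.zeroʳ _))))
      where R≈0 = if-false (y covers? z) ¬z⋖y
    weights (yes z⋖y) = begin
      R y z * q⁻¹ ^ dimˣ z                   ≈⟨ K.*-comm _ _ ⟩
      q⁻¹ ^ dimˣ z * R y z                   ≈⟨ K.*-congʳ (K.*-identityˡ _) ⟨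
      1# * q⁻¹ ^ dimˣ z * R y z              ≈⟨ K.*-congʳ (K.*-congʳ (K.trans (K.*-comm _ _) q⁻¹*q≈1)) ⟨
      qᴷ * q⁻¹ * q⁻¹ ^ dimˣ z * R y z        ≈⟨ K.*-congʳ (K.*-assoc _ _ _) ⟩
      qᴷ * q⁻¹ ^ suc (dimˣ z) * R y z        ≈⟨ K.*-assoc _ _ _ ⟩
      qᴷ * (q⁻¹ ^ suc (dimˣ z) * R y z)      ≈⟨ K.*-congˡ (K.*-congʳ (^-congʳ q⁻¹ (⋖-dim z y z⋖y))) ⟨
      qᴷ * (q⁻¹ ^ dimˣ y * R y z)            ∎

  LA* : L · A* ≋ q⁻¹ ∙ (A* · L)
  LA* y z = begin
    (L · A*) y z                         ≈⟨ ·A* L-represents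
                                              (λ y {w} {z} w≈z → ≡.cong (ℕ._* q^ (dimˣ y)) (⋖?-congʳ y {w} {z} w≈z)) y z ⟩
    L y z * q⁻¹ ^ dimˣ z                 ≈⟨ weights (z covers? y) ⟩
    q⁻¹ * (q⁻¹ ^ dimˣ y * L y z)         ≈⟨ K.*-congˡ (A*· L-represents (λ {w} {y} z w≈y →
                                              ≡.cong₂ (λ a b → a ℕ.* q^ b) (⋖?-congˡ {w} {y} z w≈y) (dimˣ-cong w y w≈y)) y z) ⟨
    q⁻¹ * (A* · L) y z                   ∎
    where
    weights : Dec (y ⋖ z) → L y z * q⁻¹ ^ dimˣ z ≈ q⁻¹ * (q⁻¹ ^ dimˣ y * L y z)
    weights (no ¬y⋖z) = K.trans (K.*-congʳ L≈0) (K.trans (K.zeroˡ _)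
      (K.sym (K.trans (K.*-congˡ (K.trans (K.*-congˡ L≈0) (K.zeroʳ _))) (K.zeroʳ _))))
      where L≈0 = if-false (z covers? y) ¬y⋖z
    weights (yes y⋖z) = begin
      L y z * q⁻¹ ^ dimˣ z                   ≈⟨ K.*-comm _ _ ⟩
      q⁻¹ ^ dimˣ z * L y z                   ≈⟨ K.*-congʳ (^-congʳ q⁻¹ (⋖-dim y z y⋖z)) ⟩
      q⁻¹ * q⁻¹ ^ dimˣ y * L y z             ≈⟨ K.*-assoc _ _ _ ⟩
      q⁻¹ * (q⁻¹ ^ dimˣ y * L y z)           ∎

proposition7p8 :
    ∀ {c ℓ ℓ# m ℓm c′ ℓ′ ℓ#′} (q N M : ℕ) → .{{NonZero N}} → .{{NonZero M}} →
    (F : HeytingField c ℓ ℓ#) (F-size : setoid F HasSize q) (H : Module (ring F) m ℓm) →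
    let open LinearAlgebra F H in
    (H-dim : HasDimension (N ℕ.+ M)) (h : Subspace) → dim h ≡ M →
    (K : HeytingField c′ ℓ′ ℓ#′) (char0 : CharacteristicZero K) →
    let open AttenuatedSpace F F-size H H-dim h
        open Matrices K char0
    in
      (R · A* ≋ qᴷ ∙ (A* · R))
    × (L · A* ≋ q⁻¹ ∙ (A* · L))
    × (L · L · R ⊖ (qᴷ * (qᴷ + 1#)) ∙ (L · R · L) ⊕ (qᴷ ^ 3) ∙ (R · L · L)
         ≋ (- (qᴷ ^ (N ℕ.+ M) * (qᴷ + 1#))) ∙ L)
    × (L · R · R ⊖ (qᴷ * (qᴷ + 1#)) ∙ (R · L · R) ⊕ (qᴷ ^ 3) ∙ (R · R · L)
         ≋ (- (qᴷ ^ (N ℕ.+ M) * (qᴷ + 1#))) ∙ R)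
proposition7p8 q N M F F-size H H-dim h _ K char0 = RA* , LA* , L²R , LR²
  where open FieldMatrices F F-size H H-dim h K char0
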